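{- Let $\mathcal{M}$ be a $2$-rigidity family in which $K_{3,3}$ is not a circuit. Then every $\mathcal{M}$-circuit is an $\mathcal{R}$-circuit.
   Context: Graphs are identified with their edge sets. $\mathcal{R}$-independence: $G$ is $\mathcal{R}$-independent iff every set of $m\ge2$ of its vertices induces at most $2m-3$ edges; $\mathcal{R}$-circuits are minimal $\mathcal{R}$-dependent graphs. A matroidal family is a sequence $(\mathcal{M}_n)_{n\ge2}$ of matroids on $\binom{[n]}{2}$, each invariant under vertex relabelling, such that a graph $\mathcal{M}_n$-independent for some $n$ is $\mathcal{M}_n$-independent for all $n\ge v(G)$; a $2$-rigidity family is one with each $\mathcal{M}_n$ of rank $2n-3$. (In the paper's terminology: $\mathcal{M}$ has no short circuits, a short $\mathcal{M}$-circuit being an $\mathcal{M}$-circuit that is not an $\mathcal{R}$-circuit.) -}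

module Defs where

open import Data.Nat as ℕ using (ℕ; zero; suc; _*_; _∸_; _≤_; _<_; _<ᵇ_; _≤ᵇ_)
open import Data.Bool using (Bool; true; false; _∧_; _∨_; if_then_else_)
open import Data.Fin as Fin using (Fin; toℕ; inject≤)
open import Data.Fin.Properties as FinP using (<-cmp; _≟_; inject≤-injective)
open import Data.Fin.Subset using (Subset; ∣_∣)
open import Data.Fin.Permutation using (Permutation′; _⟨$⟩ʳ_; _⟨$⟩ˡ_; inverseˡ)
open import Data.Vec using (lookup)
open import Data.List using (List; []; _∷_; concatMap)
open import Data.Bool.ListAction using (any)
open import Data.List.Base using (allFin)
open import Data.Product using (Σ; ∃; _×_; _,_)
open import Data.Empty using (⊥; ⊥-elim)
open import Relation.Nullary using (¬_; yes; no; does)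
open import Relation.Binary using (tri<; tri≈; tri>)
open import Relation.Binary.PropositionalEquality using (_≡_; refl; sym; trans; cong)
open import Function using (_⇔_)

record Edge (n : ℕ) : Set where
  constructor edge
  field
    lo  : Fin n
    hi  : Fin n
    lo<hi : lo Fin.< hi
open Edge public

_=ᴱ_ : ∀ {n} → Edge n → Edge n → Bool
e =ᴱ f = does (lo e ≟ lo f) ∧ does (hi e ≟ hi f)

edgesFrom : ∀ {n} → Fin n → List (Fin n) → List (Edge n)
edgesFrom i [] = []
edgesFrom i (j ∷ js) with i FinP.<? j
... | yes p = edge i j p ∷ edgesFrom i js
... | no _  = edgesFrom i js

allEdges : (n : ℕ) → List (Edge n)
allEdges n = concatMap (λ i → edgesFrom i (allFin n)) (allFin n)

-- Graphs on vertex set [n] are identified with edge sets, i.e. subsets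
-- of the edge set of K_n (decidable predicates on Edge n).

Graph : ℕ → Set
Graph n = Edge n → Bool

count : ∀ {A : Set} → (A → Bool) → List A → ℕ
count p [] = 0
count p (x ∷ xs) = if p x then suc (count p xs) else count p xs

∣_∣ᴱ : ∀ {n} → Graph n → ℕ
∣_∣ᴱ {n} G = count G (allEdges n)

∅ᴳ : ∀ {n} → Graph n
∅ᴳ _ = false

_⊆ᴳ_ : ∀ {n} → Graph n → Graph n → Set
H ⊆ᴳ G = ∀ e → H e ≡ true → G e ≡ true

_⊂ᴳ_ : ∀ {n} → Graph n → Graph n → Set
H ⊂ᴳ G = H ⊆ᴳ G × ∃ λ e → G e ≡ true × H e ≡ false

_+ᴳ_ : ∀ {n} → Graph n → Edge n → Graph n
(G +ᴳ e) f = G f ∨ (f =ᴱ e)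

Injective : ∀ {m n} → (Fin m → Fin n) → Set
Injective f = ∀ {x y} → f x ≡ f y → x ≡ y

mapEdge : ∀ {m n} (f : Fin m → Fin n) → Injective f → Edge m → Edge n
mapEdge f inj (edge i j i<j) with <-cmp (f i) (f j)
... | tri< a _ _ = edge (f i) (f j) a
... | tri≈ _ b _ = ⊥-elim (FinP.<-irrefl (inj b) i<j)
... | tri> _ _ c = edge (f j) (f i) c

image : ∀ {m n} (f : Fin m → Fin n) → Injective f → Graph m → Graph n
image {m} f inj G e′ = any (λ e → G e ∧ (mapEdge f inj e =ᴱ e′)) (allEdges m)

perm-injective : ∀ {n} (σ : Permutation′ n) → Injective (σ ⟨$⟩ʳ_)
perm-injective σ {x} {y} eq =
  trans (sym (inverseˡ σ)) (trans (cong (σ ⟨$⟩ˡ_) eq) (inverseˡ σ))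

relabel : ∀ {n} → Permutation′ n → Graph n → Graph n
relabel σ = image (σ ⟨$⟩ʳ_) (perm-injective σ)

embed : ∀ {m n} → m ≤ n → Graph m → Graph n
embed m≤n = image (λ i → inject≤ i m≤n) (λ {x} {y} → inject≤-injective m≤n m≤n x y)

record Matroid (n : ℕ) : Set₁ where
  field
    Indep      : Graph n → Set
    indep-ext  : ∀ {A B} → (∀ e → A e ≡ B e) → Indep A → Indep B
    indep-∅    : Indep ∅ᴳ
    indep-sub  : ∀ {A B} → A ⊆ᴳ B → Indep B → Indep A
    indep-aug  : ∀ {A B} → Indep A → Indep B → ∣ A ∣ᴱ < ∣ B ∣ᴱ →
                 ∃ λ e → B e ≡ true × A e ≡ false × Indep (A +ᴳ e)
open Matroid public

HasRank : ∀ {n} → Matroid n → ℕ → Set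
HasRank M r = (∃ λ B → Indep M B × ∣ B ∣ᴱ ≡ r)
            × (∀ A → Indep M A → ∣ A ∣ᴱ ≤ r)

IsCircuitOf : ∀ {n} → (Graph n → Set) → Graph n → Set
IsCircuitOf Ind G = ¬ Ind G × (∀ H → H ⊂ᴳ G → Ind H)

-- Matroidal families and 2-rigidity families.
-- M n is the matroid on the edge set of K_n (only n ≥ 2 is constrained).

record MatroidalFamily : Set₁ where
  field
    M        : (n : ℕ) → Matroid n
    relabel-inv : ∀ n (σ : Permutation′ n) (G : Graph n) →
                  Indep (M n) G → Indep (M n) (relabel σ G)
    consistent  : ∀ m n (m≤n : m ≤ n) → 2 ≤ m → (G : Graph m) →
                  Indep (M m) G ⇔ Indep (M n) (embed m≤n G)
open MatroidalFamily public

record RigidityFamily2 : Set₁ where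
  field
    family : MatroidalFamily
    rank   : ∀ n → 2 ≤ n → HasRank (M family n) (2 * n ∸ 3)
open RigidityFamily2 public

IsMCircuit : (F : MatroidalFamily) → ∀ n → Graph n → Set
IsMCircuit F n G = IsCircuitOf (Indep (M F n)) G

inducedEdges : ∀ {n} → Graph n → Subset n → ℕ
inducedEdges {n} G X =
  count (λ e → G e ∧ lookup X (lo e) ∧ lookup X (hi e)) (allEdges n)

RIndep : ∀ {n} → Graph n → Set
RIndep {n} G = ∀ (X : Subset n) → 2 ≤ ∣ X ∣ → inducedEdges G X ≤ 2 * ∣ X ∣ ∸ 3

IsRCircuit : ∀ n → Graph n → Set
IsRCircuit n G = IsCircuitOf RIndep G

K33 : Graph 6
K33 e = (toℕ (lo e) <ᵇ 3) ∧ (3 ≤ᵇ toℕ (hi e))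

-- Independence in M forces (2,3)-sparsity, because each M_k has rank 2k-3.  For the
-- converse, induct on the number of vertices.  A sparse graph has a vertex v of degree
-- at most 3.  If the degree is at most 2, deleting v is undone by a zero-extension,
-- which preserves independence in every 2-rigidity family.  If v has neighbours
-- a, b, c, then some edge on {a, b, c}, say ab, is missing from H = G - v and
-- H + ab is sparse; so it remains to see that a one-extension preserves independence.
-- Let v₁, v₂, v₃ be three copies of v and J = H + {vᵢa, vᵢb}.  If H + va + vb + vc were
-- dependent, then J would span each vᵢc, hence the K₃,₃ on {a, b, c}, {v₁, v₂, v₃}.
-- This K₃,₃ is independent with 9 edges, so it spans K₆ and in particular ab.  But
-- J + ab arises from the independent graph H + ab by three zero-extensions.

module Submission where

open import Defs
open import Data.Bool using (Bool; true; false; _∧_; _∨_; not)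
open import Data.Bool.ListAction using (any)
open import Data.Empty using (⊥; ⊥-elim)
open import Data.Fin as Fin using (Fin; zero; suc; punchIn; punchOut; inject≤; _↑ˡ_; _↑ʳ_)
open import Data.Fin.Permutation as Perm
  using (Permutation′; _⟨$⟩ʳ_; _⟨$⟩ˡ_; inverseʳ; transpose; _∘ₚ_)
import Data.Fin.Properties as FinP
open import Data.Fin.Properties using (_≟_)
open import Data.Fin.Subset using (Subset; ∣_∣)
open import Data.List using (List; []; _∷_; _++_; concatMap; allFin; tabulate; length)
open import Data.List.Membership.Propositional using (_∈_)
open import Data.List.Relation.Unary.All as All using (All; []; _∷_)
open import Data.List.Relation.Unary.AllPairs using (AllPairs; []; _∷_)
open import Data.List.Relation.Unary.Any using (here; there)
open import Data.Nat as ℕ using (ℕ; zero; suc; _+_; _*_; _∸_; _≤_; _<_; z≤n; s≤s; s≤s⁻¹; _≤?_)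
open import Data.Nat.Properties as ℕP using (≤-refl; ≤-trans; ≤-reflexive; module ≤-Reasoning)
open import Data.Nat.Tactic.RingSolver using (solve-∀)
open import Data.Product using (∃; ∃₂; _×_; _,_; proj₁; proj₂)
open import Data.Sum using (_⊎_; inj₁; inj₂; [_,_]′)
open import Data.Vec as Vec using ([]; _∷_)
open import Data.Vec.Relation.Unary.All using ([]; _∷_)
open import Data.Vec.Relation.Unary.AllPairs using ([]; _∷_)
import Data.Vec.Properties as VecP
import Data.Vec.Relation.Unary.Unique.Propositional.Properties as VecU
open import Function using (_∘_; Equivalence)
open import Relation.Binary.PropositionalEquality
  using (_≡_; _≢_; refl; sym; trans; cong; cong₂; subst; subst₂; ≢-sym)
open import Relation.Binary using (tri<; tri≈; tri>)
open import Relation.Nullary using (¬_; Dec; yes; no; does; contradiction)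
open import Relation.Nullary.Decidable using (dec-true; dec-false)

-- Independence is an arbitrary predicate without a decision procedure, so the converse direction
-- and the independence of K₃,₃ are reached only up to double negation. This is enough: that a graph
-- fails to be R-independent is itself a negative statement.
--
-- Three copies of v need two vertices that the graph may not have. The graph is therefore moved to
-- n + 2 vertices, two of them isolated, and consistency of the family brings the conclusion back.
-- The closure argument becomes a count: an independent set that contains K₃,₃ and is at least as
-- large as J + ab must augment J.
--
-- A suitable pair ab exists because otherwise each pair from {a, b, c} lies in a tight set (2m - 3
-- edges on m vertices) missing v. The three sets merge into one tight set containing a, b, c, and
-- putting v back adds three edges where sparsity allows two.
--
-- K₃,₃ has exactly the size of a basis, 9 = 2·6 - 3, and its proper subgraphs are independent by
-- zero-extensions alone, so its not being a circuit excludes its dependence. Zero-extensions work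
-- in every 2-rigidity family because each new vertex raises the rank by exactly 2.

private variable
  m n : ℕ

-- Counting

ind : Bool → ℕ
ind true  = 1
ind false = 0

∑ : {A : Set} → (A → ℕ) → List A → ℕ
∑ f []       = 0
∑ f (x ∷ xs) = f x + ∑ f xs

∑-mono : {A : Set} {f g : A → ℕ} (xs : List A) → (∀ x → f x ≤ g x) → ∑ f xs ≤ ∑ g xs
∑-mono []       f≤g = z≤n
∑-mono (x ∷ xs) f≤g = ℕP.+-mono-≤ (f≤g x) (∑-mono xs f≤g)

∑-cong : {A : Set} {f g : A → ℕ} (xs : List A) → (∀ x → f x ≡ g x) → ∑ f xs ≡ ∑ g xs
∑-cong []       f≡g = refl
∑-cong (x ∷ xs) f≡g = cong₂ _+_ (f≡g x) (∑-cong xs f≡g)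

∑-+ : {A : Set} (f g : A → ℕ) (xs : List A) → ∑ (λ x → f x + g x) xs ≡ ∑ f xs + ∑ g xs
∑-+ f g []       = refl
∑-+ f g (x ∷ xs) rewrite ∑-+ f g xs = interchange (f x) (g x) (∑ f xs) (∑ g xs)
  where
  interchange : ∀ a b c d → a + b + (c + d) ≡ a + c + (b + d)
  interchange = solve-∀

∑-* : {A : Set} (k : ℕ) (f : A → ℕ) (xs : List A) → ∑ (λ x → k * f x) xs ≡ k * ∑ f xs
∑-* k f []       = sym (ℕP.*-zeroʳ k)
∑-* k f (x ∷ xs) rewrite ∑-* k f xs = sym (ℕP.*-distribˡ-+ k (f x) (∑ f xs))

∑-zero : {A : Set} (xs : List A) → ∑ (λ _ → 0) xs ≡ 0
∑-zero []       = refl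
∑-zero (x ∷ xs) = ∑-zero xs

∑-swap : {A B : Set} (f : A → B → ℕ) (xs : List A) (ys : List B) →
         ∑ (λ x → ∑ (f x) ys) xs ≡ ∑ (λ y → ∑ (λ x → f x y) xs) ys
∑-swap f []       ys = sym (∑-zero ys)
∑-swap f (x ∷ xs) ys rewrite ∑-swap f xs ys =
  sym (∑-+ (f x) (λ y → ∑ (λ z → f z y) xs) ys)

∑-<⇒∃ : {A : Set} {f g : A → ℕ} (xs : List A) → ∑ f xs < ∑ g xs → ∃ λ x → f x < g x
∑-<⇒∃ {f = f} {g} (x ∷ xs) lt with suc (f x) ≤? g x
... | yes p = x , p
... | no ¬p = ∑-<⇒∃ xs (ℕP.≰⇒> λ ge →
                contradiction lt (ℕP.≤⇒≯ (ℕP.+-mono-≤ (ℕP.≮⇒≥ ¬p) ge)))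

count≡∑ : {A : Set} (p : A → Bool) (xs : List A) → count p xs ≡ ∑ (ind ∘ p) xs
count≡∑ p []       = refl
count≡∑ p (x ∷ xs) with p x
... | true  = cong suc (count≡∑ p xs)
... | false = count≡∑ p xs

∑-++ : {A : Set} (f : A → ℕ) (xs ys : List A) → ∑ f (xs ++ ys) ≡ ∑ f xs + ∑ f ys
∑-++ f []       ys = refl
∑-++ f (x ∷ xs) ys rewrite ∑-++ f xs ys = sym (ℕP.+-assoc (f x) _ _)

∑-concatMap : {A B : Set} (f : B → ℕ) (g : A → List B) (xs : List A) →
              ∑ f (concatMap g xs) ≡ ∑ (λ x → ∑ f (g x)) xs
∑-concatMap f g []       = refl
∑-concatMap f g (x ∷ xs) =
  trans (∑-++ f (g x) (concatMap g xs)) (cong (∑ f (g x) +_) (∑-concatMap f g xs))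

∑-const0 : {A : Set} {f : A → ℕ} (xs : List A) → (∀ x → f x ≡ 0) → ∑ f xs ≡ 0
∑-const0 xs f≡0 = trans (∑-cong xs f≡0) (∑-zero xs)

does-true : {P : Set} (d : Dec P) → does d ≡ true → P
does-true (yes p) _ = p

∧-true : ∀ {x y} → x ∧ y ≡ true → x ≡ true × y ≡ true
∧-true {true} {true} _ = refl , refl

∧-intro : ∀ {x y} → x ≡ true → y ≡ true → x ∧ y ≡ true
∧-intro refl refl = refl

∨-true : ∀ {x y} → x ∨ y ≡ true → x ≡ true ⊎ y ≡ true
∨-true {true}  _ = inj₁ refl
∨-true {false} p = inj₂ p

∨-introˡ : ∀ {x y} → x ≡ true → x ∨ y ≡ true
∨-introˡ refl = refl

∨-introʳ : ∀ {x y} → y ≡ true → x ∨ y ≡ true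
∨-introʳ {true}  _ = refl
∨-introʳ {false} p = p

true≢false : {b : Bool} → b ≡ true → b ≡ false → ⊥
true≢false refl ()

≢true⇒false : {b : Bool} → ¬ b ≡ true → b ≡ false
≢true⇒false {true}  ¬p = ⊥-elim (¬p refl)
≢true⇒false {false} ¬p = refl

not-true : {b : Bool} → not b ≡ true → b ≡ false
not-true {false} _ = refl

not-intro : {b : Bool} → b ≡ false → not b ≡ true
not-intro refl = refl

ind-∨ : ∀ p q → ind (p ∨ q) ≤ ind p + ind q
ind-∨ true  q = s≤s z≤n
ind-∨ false q = ≤-refl

ind-mono : ∀ {b c} → (b ≡ true → c ≡ true) → ind b ≤ ind c
ind-mono {true}  b⇒c rewrite b⇒c refl = ≤-refl
ind-mono {false} b⇒c = z≤n

any-false : {A : Set} (p : A → Bool) (xs : List A) → any p xs ≡ false → ∑ (ind ∘ p) xs ≡ 0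
any-false p []       _  = refl
any-false p (x ∷ xs) eq with p x
... | false = any-false p xs eq

any-true : {A : Set} (p : A → Bool) (xs : List A) → any p xs ≡ true → ∃ λ x → p x ≡ true
any-true p (x ∷ xs) eq with p x in px
... | true  = x , px
... | false = any-true p xs eq

∑-fin-singleton : (a : Fin n) → ∑ (λ x → ind (does (x ≟ a))) (allFin n) ≡ 1
-- `allFin` is `tabulate` of the identity; passing to an arbitrary injection lets the recursion
-- shift it to `f ∘ suc`.
∑-fin-singleton {n} a = go (λ i → i) a (λ p → p)
  where
  go : ∀ {k} (f : Fin k → Fin n) (j : Fin k) → Injective f →
       ∑ (λ x → ind (does (x ≟ f j))) (tabulate f) ≡ 1
  miss : ∀ {k} (f : Fin k → Fin n) {b} → (∀ i → f i ≢ b) →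
         ∑ (λ x → ind (does (x ≟ b))) (tabulate f) ≡ 0
  miss {zero}  f ≢b = refl
  miss {suc k} f {b} ≢b rewrite dec-false (f zero ≟ b) (≢b zero) =
    miss (f ∘ suc) (≢b ∘ suc)
  go f zero    inj rewrite dec-true (f zero ≟ f zero) refl =
    cong suc (miss (f ∘ suc) (λ i eq → contradiction (inj eq) λ ()))
  go f (suc j) inj rewrite dec-false (f zero ≟ f (suc j)) (λ eq → contradiction (inj eq) λ ()) =
    go (f ∘ suc) j (FinP.suc-injective ∘ inj)

-- Edges

edge-≡ : {e f : Edge n} → lo e ≡ lo f → hi e ≡ hi f → e ≡ f
edge-≡ {e = edge i j p} {edge i j q} refl refl = cong (edge i j) (FinP.<-irrelevant p q)

=ᴱ⇒≡ : (e f : Edge n) → (e =ᴱ f) ≡ true → e ≡ f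
=ᴱ⇒≡ e f eq with ∧-true eq
... | p , q = edge-≡ (does-true (lo e ≟ lo f) p) (does-true (hi e ≟ hi f) q)

=ᴱ-refl : (e : Edge n) → (e =ᴱ e) ≡ true
=ᴱ-refl e = ∧-intro (dec-true (lo e ≟ lo e) refl) (dec-true (hi e ≟ hi e) refl)

-- Completeness of `allEdges` and absence of repetitions in one equation: the row of `lo e` lists
-- `e` once and no other row lists it.
∑-edge-singleton : (e : Edge n) → ∑ (λ f → ind (f =ᴱ e)) (allEdges n) ≡ 1
∑-edge-singleton {n} e = trans (∑-concatMap _ (λ i → edgesFrom i (allFin n)) (allFin n))
  (trans (∑-cong (allFin n) row) (∑-fin-singleton (lo e)))
  where
  miss : ∀ i → i ≢ lo e → ∀ js → ∑ (λ f → ind (f =ᴱ e)) (edgesFrom i js) ≡ 0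
  miss i i≢ [] = refl
  miss i i≢ (j ∷ js) with i FinP.<? j
  ... | yes p rewrite dec-false (i ≟ lo e) i≢ = miss i i≢ js
  ... | no _  = miss i i≢ js
  hit : ∀ js → ∑ (λ f → ind (f =ᴱ e)) (edgesFrom (lo e) js) ≡ ∑ (λ j → ind (does (j ≟ hi e))) js
  hit [] = refl
  hit (j ∷ js) with lo e FinP.<? j
  ... | yes p rewrite dec-true (lo e ≟ lo e) refl = cong (ind (does (j ≟ hi e)) +_) (hit js)
  ... | no ¬p rewrite dec-false (j ≟ hi e) (λ { refl → ¬p (lo<hi e) }) = hit js
  row : ∀ i → ∑ (λ f → ind (f =ᴱ e)) (edgesFrom i (allFin n)) ≡ ind (does (i ≟ lo e))
  row i with i ≟ lo e
  ... | yes refl = trans (hit (allFin n)) (∑-fin-singleton (hi e))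
  ... | no  i≢   = miss i i≢ (allFin n)

-- A failed search would make the indicator sum of `p` zero, yet that sum dominates the singleton
-- sum of `e`, which is 1.
anyEdge-intro : (p : Edge n → Bool) (e : Edge n) → p e ≡ true → any p (allEdges n) ≡ true
anyEdge-intro {n} p e pe with any p (allEdges n) in eq
... | true  = refl
... | false = contradiction
  (ℕP.≤-trans (≤-reflexive (sym (∑-edge-singleton e)))
    (ℕP.≤-trans (∑-mono (allEdges n) λ f → ind-mono λ f=e → subst (λ z → p z ≡ true) (sym (=ᴱ⇒≡ f e f=e)) pe)
      (≤-reflexive (any-false p (allEdges n) eq))))
  λ ()

-- Forgets which end is the smaller one. Relabelling may reverse the order of the ends, and this
-- view keeps that case split out of later proofs.
data Joins {n} (a b : Fin n) : Edge n → Set where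
  fwd : (p : a Fin.< b) → Joins a b (edge a b p)
  bwd : (p : b Fin.< a) → Joins a b (edge b a p)

joins-sym : {a b : Fin n} {e : Edge n} → Joins a b e → Joins b a e
joins-sym (fwd p) = bwd p
joins-sym (bwd p) = fwd p

joins-self : (e : Edge n) → Joins (lo e) (hi e) e
joins-self e = fwd (lo<hi e)

joins-cong : {a a′ b b′ : Fin n} {e : Edge n} → a ≡ a′ → b ≡ b′ → Joins a b e → Joins a′ b′ e
joins-cong refl refl J = J

joins-≢ : {a b : Fin n} {e : Edge n} → Joins a b e → a ≢ b
joins-≢ (fwd p) refl = FinP.<-irrefl refl p
joins-≢ (bwd p) refl = FinP.<-irrefl refl p

joins-unique : {a b : Fin n} {e f : Edge n} → Joins a b e → Joins a b f → e ≡ f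
joins-unique (fwd p) (fwd q) = edge-≡ refl refl
joins-unique (fwd p) (bwd q) = contradiction q (FinP.<-asym p)
joins-unique (bwd p) (fwd q) = contradiction q (FinP.<-asym p)
joins-unique (bwd p) (bwd q) = edge-≡ refl refl

joining : {a b : Fin n} → a ≢ b → ∃ (Joins a b)
joining {a = a} {b} a≢b with FinP.<-cmp a b
... | tri< p _ _ = edge a b p , fwd p
... | tri≈ _ p _ = contradiction p a≢b
... | tri> _ _ p = edge b a p , bwd p

inc : Fin n → Edge n → Bool
inc v e = does (v ≟ lo e) ∨ does (v ≟ hi e)

inc⇒joins : {v : Fin n} {e : Edge n} → inc v e ≡ true → ∃ λ x → Joins v x e
inc⇒joins {v = v} {e} eq with ∨-true {does (v ≟ lo e)} eq
... | inj₁ p with does-true (v ≟ lo e) p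
...   | refl = hi e , joins-self e
inc⇒joins {v = v} {e} eq | inj₂ p with does-true (v ≟ hi e) p
... | refl = lo e , joins-sym (joins-self e)

joins⇒inc : {v x : Fin n} {e : Edge n} → Joins v x e → inc v e ≡ true
joins⇒inc {v = v} (fwd p) = ∨-introˡ (dec-true (v ≟ v) refl)
joins⇒inc {v = v} (bwd p) = ∨-introʳ (dec-true (v ≟ v) refl)

mapEdge-joins : (f : Fin m → Fin n) (inj : Injective f) {a b : Fin m} {e : Edge m} →
                Joins a b e → Joins (f a) (f b) (mapEdge f inj e)
mapEdge-joins f inj {a} {b} (fwd p) with FinP.<-cmp (f a) (f b)
... | tri< q _ _ = fwd q
... | tri≈ _ q _ = contradiction p (FinP.<-irrefl (inj q))
... | tri> _ _ q = bwd q
mapEdge-joins f inj {a} {b} (bwd p) with FinP.<-cmp (f b) (f a)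
... | tri< q _ _ = bwd q
... | tri≈ _ q _ = contradiction p (FinP.<-irrefl (inj q))
... | tri> _ _ q = fwd q

mapEdge-preimage : (f : Fin m → Fin n) (inj : Injective f) {a b : Fin m} {e′ : Edge n} →
                   Joins (f a) (f b) e′ → ∃ λ e → Joins a b e × mapEdge f inj e ≡ e′
mapEdge-preimage f inj J with joining (λ a≡b → joins-≢ J (cong f a≡b))
... | e , j = e , j , joins-unique (mapEdge-joins f inj j) J

joins-ends : {a b c d : Fin n} {e : Edge n} → Joins a b e → Joins c d e →
             (a ≡ c × b ≡ d) ⊎ (a ≡ d × b ≡ c)
joins-ends (fwd p) (fwd q) = inj₁ (refl , refl)
joins-ends (fwd p) (bwd q) = inj₂ (refl , refl)
joins-ends (bwd p) (fwd q) = inj₂ (refl , refl)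
joins-ends (bwd p) (bwd q) = inj₁ (refl , refl)

mapEdge-injective : (f : Fin m → Fin n) (inj : Injective f) {e e′ : Edge m} →
                    mapEdge f inj e ≡ mapEdge f inj e′ → e ≡ e′
mapEdge-injective f inj {e} {e′} eq
  with joins-ends (subst (Joins _ _) eq (mapEdge-joins f inj (joins-self e)))
                  (mapEdge-joins f inj (joins-self e′))
... | inj₁ (p , q) = edge-≡ (inj p) (inj q)
... | inj₂ (p , q) =
  joins-unique (joins-cong (inj p) (inj q) (joins-self e)) (joins-sym (joins-self e′))

-- Graphs and their sizes

infix 4 _∈ᴳ_

_∈ᴳ_ : Edge n → Graph n → Set
e ∈ᴳ G = G e ≡ true

∈ᴳ? : (G : Graph n) (e : Edge n) → e ∈ᴳ G ⊎ G e ≡ false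
∈ᴳ? G e with G e
... | true  = inj₁ refl
... | false = inj₂ refl

+ᴳ-elim : (G : Graph n) (e : Edge n) {f : Edge n} → f ∈ᴳ (G +ᴳ e) → f ∈ᴳ G ⊎ f ≡ e
+ᴳ-elim G e {f} p with ∨-true {G f} p
... | inj₁ q = inj₁ q
... | inj₂ q = inj₂ (=ᴱ⇒≡ f e q)

+ᴳ-old : (G : Graph n) (e : Edge n) → G ⊆ᴳ (G +ᴳ e)
+ᴳ-old G e f = ∨-introˡ

+ᴳ-new : (G : Graph n) (e : Edge n) → e ∈ᴳ (G +ᴳ e)
+ᴳ-new G e = ∨-introʳ {G e} (=ᴱ-refl e)

+ᴳ-⊆ : (G H : Graph n) (e : Edge n) → G ⊆ᴳ H → e ∈ᴳ H → (G +ᴳ e) ⊆ᴳ H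
+ᴳ-⊆ G H e G⊆H e∈H f f∈ with +ᴳ-elim G e f∈
... | inj₁ p    = G⊆H f p
... | inj₂ refl = e∈H

+ᴳ-mono : (G H : Graph n) (e : Edge n) → G ⊆ᴳ H → (G +ᴳ e) ⊆ᴳ (H +ᴳ e)
+ᴳ-mono G H e G⊆H = +ᴳ-⊆ G (H +ᴳ e) e (λ f p → +ᴳ-old H e f (G⊆H f p)) (+ᴳ-new H e)

+ᴳ²-old : (G : Graph n) (e f : Edge n) → G ⊆ᴳ ((G +ᴳ e) +ᴳ f)
+ᴳ²-old G e f g p = +ᴳ-old (G +ᴳ e) f g (+ᴳ-old G e g p)

+ᴳ²-new₁ : (G : Graph n) (e f : Edge n) → e ∈ᴳ ((G +ᴳ e) +ᴳ f)
+ᴳ²-new₁ G e f = +ᴳ-old (G +ᴳ e) f e (+ᴳ-new G e)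

+ᴳ²-new₂ : (G : Graph n) (e f : Edge n) → f ∈ᴳ ((G +ᴳ e) +ᴳ f)
+ᴳ²-new₂ G e f = +ᴳ-new (G +ᴳ e) f

∉+ᴳ : (G : Graph n) (e : Edge n) {f : Edge n} → (G +ᴳ e) f ≡ false → G f ≡ false × f ≢ e
∉+ᴳ G e f∉ = ≢true⇒false (λ p → true≢false (+ᴳ-old G e _ p) f∉)
           , λ { refl → true≢false (+ᴳ-new G e) f∉ }

size≡∑ : (G : Graph n) → ∣ G ∣ᴱ ≡ ∑ (ind ∘ G) (allEdges n)
size≡∑ {n} G = count≡∑ G (allEdges n)

size-mono : (G H : Graph n) → G ⊆ᴳ H → ∣ G ∣ᴱ ≤ ∣ H ∣ᴱ
size-mono {n} G H G⊆H rewrite size≡∑ G | size≡∑ H =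
  ∑-mono (allEdges n) λ e → ind-mono (G⊆H e)

size-+ᴳ : (G : Graph n) (e : Edge n) → G e ≡ false → ∣ G +ᴳ e ∣ᴱ ≡ suc ∣ G ∣ᴱ
size-+ᴳ {n} G e e∉ rewrite size≡∑ (G +ᴳ e) | size≡∑ G =
  trans (∑-cong (allEdges n) pointwise)
    (trans (∑-+ (λ f → ind (f =ᴱ e)) (ind ∘ G) (allEdges n))
      (cong (_+ ∑ (ind ∘ G) (allEdges n)) (∑-edge-singleton e)))
  where
  pointwise : ∀ f → ind ((G +ᴳ e) f) ≡ ind (f =ᴱ e) + ind (G f)
  pointwise f with G f in Gf | f =ᴱ e in f=e
  ... | true  | true  with =ᴱ⇒≡ f e f=e
  ...   | refl = ⊥-elim (true≢false Gf e∉)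
  pointwise f | true  | false = refl
  pointwise f | false | true  = refl
  pointwise f | false | false = refl

size-+ᴳ-≤ : (G : Graph n) (e : Edge n) → ∣ G +ᴳ e ∣ᴱ ≤ suc ∣ G ∣ᴱ
size-+ᴳ-≤ G e with ∈ᴳ? G e
... | inj₁ e∈ = ≤-trans (size-mono _ G (+ᴳ-⊆ G G e (λ _ p → p) e∈)) (ℕP.n≤1+n _)
... | inj₂ e∉ = ≤-reflexive (size-+ᴳ G e e∉)

size-zero : (G : Graph n) → (∀ e → ¬ e ∈ᴳ G) → ∣ G ∣ᴱ ≡ 0
size-zero {n} G none = trans (size≡∑ G)
  (∑-const0 (allEdges n) λ e → cong ind (≢true⇒false (none e)))

size-∅ : ∣ ∅ᴳ {n} ∣ᴱ ≡ 0
size-∅ {n} = size-zero (∅ᴳ {n}) λ _ ()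

size-pos : (G : Graph n) (e : Edge n) → e ∈ᴳ G → 1 ≤ ∣ G ∣ᴱ
size-pos {n} G e e∈ = ≤-trans
  (≤-reflexive (sym (trans (size-+ᴳ ∅ᴳ e refl) (cong suc (size-∅ {n})))))
  (size-mono (∅ᴳ +ᴳ e) G (+ᴳ-⊆ ∅ᴳ G e (λ _ ()) e∈))

size-<⇒∃ : {G H : Graph n} → ∣ G ∣ᴱ < ∣ H ∣ᴱ → ∃ λ e → e ∈ᴳ H × G e ≡ false
size-<⇒∃ {n} {G} {H} lt rewrite size≡∑ G | size≡∑ H with ∑-<⇒∃ (allEdges n) lt
... | e , p with G e in Ge | H e in He
...   | false | true  = e , He , Ge
...   | true  | true  = contradiction p (ℕP.<-irrefl refl)
size-<⇒∃ _ | e , () | true | false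
size-<⇒∃ _ | e , () | false | false

-- Images and pullbacks of graphs along vertex injections

pullback : (f : Fin m → Fin n) → Injective f → Graph n → Graph m
pullback f inj G e = G (mapEdge f inj e)

image-intro : (f : Fin m → Fin n) (inj : Injective f) (G : Graph m) (e : Edge m) →
              e ∈ᴳ G → mapEdge f inj e ∈ᴳ image f inj G
image-intro f inj G e e∈ = anyEdge-intro _ e (∧-intro e∈ (=ᴱ-refl (mapEdge f inj e)))

image-elim : (f : Fin m → Fin n) (inj : Injective f) (G : Graph m) (e′ : Edge n) →
             e′ ∈ᴳ image f inj G → ∃ λ e → e ∈ᴳ G × mapEdge f inj e ≡ e′
image-elim {m} f inj G e′ p with any-true _ (allEdges m) p
... | e , q with ∧-true q
...   | e∈ , eq = e , e∈ , =ᴱ⇒≡ _ _ eq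

-- Double counting of the pairs (e, g e) with e in `G`: each such e has a row sum of 1, and
-- injectivity keeps every column sum at most 1, with 0 outside `H`.
size-inj : {G : Graph m} {H : Graph n} (g : Edge m → Edge n) →
           (∀ {e e′} → g e ≡ g e′ → e ≡ e′) → (∀ e → e ∈ᴳ G → g e ∈ᴳ H) → ∣ G ∣ᴱ ≤ ∣ H ∣ᴱ
size-inj {m} {n} {G} {H} g g-inj G⊆H rewrite size≡∑ G | size≡∑ H = begin
  ∑ (ind ∘ G) (allEdges m)
    ≤⟨ ∑-mono (allEdges m) row ⟩
  ∑ (λ e → ∑ (λ e′ → ind (hit e e′)) (allEdges n)) (allEdges m)
    ≡⟨ ∑-swap (λ e e′ → ind (hit e e′)) (allEdges m) (allEdges n) ⟩
  ∑ (λ e′ → ∑ (λ e → ind (hit e e′)) (allEdges m)) (allEdges n)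
    ≤⟨ ∑-mono (allEdges n) column ⟩
  ∑ (ind ∘ H) (allEdges n) ∎
  where
  open ≤-Reasoning
  hit : Edge m → Edge n → Bool
  hit e e′ = G e ∧ (e′ =ᴱ g e)
  row : ∀ e → ind (G e) ≤ ∑ (λ e′ → ind (hit e e′)) (allEdges n)
  row e with G e
  ... | true  = ≤-reflexive (sym (∑-edge-singleton (g e)))
  ... | false = z≤n
  column : ∀ e′ → ∑ (λ e → ind (hit e e′)) (allEdges m) ≤ ind (H e′)
  column e′ with any (λ e → hit e e′) (allEdges m) in eq
  ... | false = ≤-trans (≤-reflexive (any-false _ (allEdges m) eq)) z≤n
  ... | true  with any-true (λ e → hit e e′) (allEdges m) eq
  ...   | e₀ , h₀ with ∧-true h₀
  ...     | e₀∈ , q₀ with =ᴱ⇒≡ e′ (g e₀) q₀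
  ...       | refl rewrite G⊆H e₀ e₀∈ =
    ≤-trans (∑-mono (allEdges m) λ e → ind-mono λ h →
              subst (λ z → (z =ᴱ e₀) ≡ true)
                (g-inj (=ᴱ⇒≡ (g e₀) (g e) (proj₂ (∧-true {G e} h)))) (=ᴱ-refl e₀))
            (≤-reflexive (∑-edge-singleton e₀))

size-image : (f : Fin m → Fin n) (inj : Injective f) (G : Graph m) → ∣ G ∣ᴱ ≤ ∣ image f inj G ∣ᴱ
size-image f inj G =
  size-inj (mapEdge f inj) (mapEdge-injective f inj) (image-intro f inj G)

-- The same double count in the other direction: every edge of `A` has some preimage, and an edge
-- below is the preimage of only one edge above.
size-pullback : (f : Fin m → Fin n) (inj : Injective f) (A : Graph n) →
                (∀ e′ → e′ ∈ᴳ A → ∃ λ e → mapEdge f inj e ≡ e′) → ∣ A ∣ᴱ ≤ ∣ pullback f inj A ∣ᴱ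
size-pullback {m} {n} f inj A onto rewrite size≡∑ A | size≡∑ (pullback f inj A) = begin
  ∑ (ind ∘ A) (allEdges n)
    ≤⟨ ∑-mono (allEdges n) row ⟩
  ∑ (λ e′ → ∑ (λ e → ind (hit e′ e)) (allEdges m)) (allEdges n)
    ≡⟨ ∑-swap (λ e′ e → ind (hit e′ e)) (allEdges n) (allEdges m) ⟩
  ∑ (λ e → ∑ (λ e′ → ind (hit e′ e)) (allEdges n)) (allEdges m)
    ≤⟨ ∑-mono (allEdges m) column ⟩
  ∑ (ind ∘ pullback f inj A) (allEdges m) ∎
  where
  open ≤-Reasoning
  hit : Edge n → Edge m → Bool
  hit e′ e = pullback f inj A e ∧ (e′ =ᴱ mapEdge f inj e)
  row : ∀ e′ → ind (A e′) ≤ ∑ (λ e → ind (hit e′ e)) (allEdges m)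
  row e′ with A e′ in Ae′
  ... | false = z≤n
  ... | true with onto e′ Ae′
  ...   | e₀ , refl = ≤-trans (≤-reflexive (sym (∑-edge-singleton e₀)))
    (∑-mono (allEdges m) λ e → ind-mono λ e=e₀ →
      subst (λ z → hit e′ z ≡ true) (sym (=ᴱ⇒≡ e e₀ e=e₀)) (∧-intro Ae′ (=ᴱ-refl e′)))
  column : ∀ e → ∑ (λ e′ → ind (hit e′ e)) (allEdges n) ≤ ind (pullback f inj A e)
  column e with pullback f inj A e
  ... | true  = ≤-reflexive (∑-edge-singleton (mapEdge f inj e))
  ... | false = ≤-reflexive (∑-zero (allEdges n))

Avoids : Fin n → Graph n → Set
Avoids v G = ∀ x e → Joins v x e → ¬ e ∈ᴳ G

avoids-+ᴳ : (G : Graph n) {v p q : Fin n} {e : Edge n} →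
            Avoids v G → Joins p q e → v ≢ p → v ≢ q → Avoids v (G +ᴳ e)
avoids-+ᴳ G {e = e} av J v≢p v≢q x f K f∈ with +ᴳ-elim G e f∈
... | inj₁ f∈G = av x f K f∈G
... | inj₂ refl with joins-ends K J
...   | inj₁ (v≡p , _) = v≢p v≡p
...   | inj₂ (v≡q , _) = v≢q v≡q

avoids-+ᴳ-inc : (G : Graph n) {v : Fin n} (e : Edge n) →
                Avoids v G → inc v e ≡ false → Avoids v (G +ᴳ e)
avoids-+ᴳ-inc G e av e∌v x f K f∈ with +ᴳ-elim G e f∈
... | inj₁ f∈G  = av x f K f∈G
... | inj₂ refl = true≢false (joins⇒inc K) e∌v

-- Augmentation

-- Augmentation repeated until the size of `B` is reached. The record that new edges come from `B`
-- is what later preserves avoidance of a vertex and identifies an augmenting edge.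
extend : (M : Matroid n) {A B : Graph n} → Indep M A → Indep M B →
         ∃ λ I → A ⊆ᴳ I × (∀ e → e ∈ᴳ I → e ∈ᴳ A ⊎ e ∈ᴳ B) × Indep M I × ∣ B ∣ᴱ ≤ ∣ I ∣ᴱ
extend {n} M {A} {B} iA iB = go ∣ B ∣ᴱ A iA (ℕP.m≤m+n _ _)
  where
  Goal : Graph n → Set
  Goal A = ∃ λ I → A ⊆ᴳ I × (∀ e → e ∈ᴳ I → e ∈ᴳ A ⊎ e ∈ᴳ B) × Indep M I × ∣ B ∣ᴱ ≤ ∣ I ∣ᴱ
  -- The fuel `k` bounds how far `A` still falls short of the size of `B`.
  go : ∀ k A → Indep M A → ∣ B ∣ᴱ ≤ k + ∣ A ∣ᴱ → Goal A
  go zero    A iA B≤ = A , (λ _ p → p) , (λ _ → inj₁) , iA , B≤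
  go (suc k) A iA B≤ with ∣ B ∣ᴱ ≤? ∣ A ∣ᴱ
  ... | yes B≤A = A , (λ _ p → p) , (λ _ → inj₁) , iA , B≤A
  ... | no  B≰A with indep-aug M iA iB (ℕP.≰⇒> B≰A)
  ...   | e , e∈B , e∉A , i with go k (A +ᴳ e) i (≤-trans B≤ (≤-reflexive
            (trans (sym (ℕP.+-suc k ∣ A ∣ᴱ)) (cong (k +_) (sym (size-+ᴳ A e e∉A))))))
  ...     | I , A⊆I , I⊆ , iI , B≤I =
    I , (λ f p → A⊆I f (+ᴳ-old A e f p)) , (λ f p → back f (I⊆ f p)) , iI , B≤I
    where
    back : ∀ f → f ∈ᴳ (A +ᴳ e) ⊎ f ∈ᴳ B → f ∈ᴳ A ⊎ f ∈ᴳ B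
    back f (inj₂ p) = inj₂ p
    back f (inj₁ p) with +ᴳ-elim A e p
    ... | inj₁ q    = inj₁ q
    ... | inj₂ refl = inj₂ e∈B

-- Vertex injections

transposeˡ : (i j : Fin n) → transpose i j ⟨$⟩ʳ i ≡ j
transposeˡ i j rewrite dec-true (i ≟ i) refl = refl

transposeʳ : (i j : Fin n) → transpose i j ⟨$⟩ʳ j ≡ i
transposeʳ i j with j ≟ i
... | yes refl = refl
... | no _ rewrite dec-true (j ≟ j) refl = refl

transpose-other : {i j k : Fin n} → k ≢ i → k ≢ j → transpose i j ⟨$⟩ʳ k ≡ k
transpose-other {i = i} {j} {k} k≢i k≢j
  rewrite dec-false (k ≟ i) k≢i | dec-false (k ≟ j) k≢j = refl

-- The family axioms mention only permutations and the standard inclusions; this reduces arbitrary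
-- injections to them. Points are matched one at a time: the new transposition fixes those already
-- in place, since both of its points differ from them.
aligning : (g f : Fin m → Fin n) → Injective g → Injective f →
           ∃ λ (σ : Permutation′ n) → ∀ i → σ ⟨$⟩ʳ g i ≡ f i
aligning {zero}  g f gi fi = Perm.id , λ ()
aligning {suc m} g f gi fi with aligning (g ∘ suc) (f ∘ suc) (FinP.suc-injective ∘ gi) (FinP.suc-injective ∘ fi)
... | σ , σg≡f = σ ∘ₚ transpose (σ ⟨$⟩ʳ g zero) (f zero) , agree
  where
  agree : ∀ i → transpose (σ ⟨$⟩ʳ g zero) (f zero) ⟨$⟩ʳ (σ ⟨$⟩ʳ g i) ≡ f i
  agree zero    = transposeˡ (σ ⟨$⟩ʳ g zero) (f zero)
  agree (suc i) = trans
    (transpose-other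
      (λ eq → contradiction (gi (perm-injective σ eq)) λ ())
      (λ eq → contradiction (fi (trans (sym (σg≡f i)) eq)) λ ()))
    (σg≡f i)

module Family (F : MatroidalFamily) where

  indep-image : (f : Fin m → Fin n) (inj : Injective f) → 2 ≤ m → {G : Graph m} →
                Indep (M F m) G → Indep (M F n) (image f inj G)
  indep-image {m} {n} f inj 2≤m {G} iG =
    indep-sub (M F n) sub
      (relabel-inv F n σ _ (Equivalence.to (consistent F m n m≤n 2≤m G) iG))
    where
    m≤n : m ≤ n
    m≤n = FinP.injective⇒≤ inj
    ι : Fin m → Fin n
    ι i = inject≤ i m≤n
    ι-inj : Injective ι
    ι-inj {x} {y} = FinP.inject≤-injective m≤n m≤n x y
    al = aligning ι f ι-inj inj
    σ = proj₁ al
    sub : image f inj G ⊆ᴳ relabel σ (embed m≤n G)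
    sub e′ e′∈ with image-elim f inj G e′ e′∈
    ... | e , e∈ , refl = subst (_∈ᴳ relabel σ (embed m≤n G))
      (joins-unique
        (mapEdge-joins _ (perm-injective σ) (mapEdge-joins ι ι-inj (joins-self e)))
        (joins-cong (sym (proj₂ al (lo e))) (sym (proj₂ al (hi e))) (mapEdge-joins f inj (joins-self e))))
      (image-intro _ (perm-injective σ) (embed m≤n G) _ (image-intro ι ι-inj G e e∈))

  indep-pullback : (f : Fin m → Fin n) (inj : Injective f) → 2 ≤ m → {A : Graph n} →
                   Indep (M F n) A → Indep (M F m) (pullback f inj A)
  indep-pullback {m} {n} f inj 2≤m {A} iA =
    Equivalence.from (consistent F m n m≤n 2≤m _) (indep-sub (M F n) sub (relabel-inv F n σ A iA))
    where
    m≤n : m ≤ n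
    m≤n = FinP.injective⇒≤ inj
    ι : Fin m → Fin n
    ι i = inject≤ i m≤n
    ι-inj : Injective ι
    ι-inj {x} {y} = FinP.inject≤-injective m≤n m≤n x y
    al = aligning f ι inj ι-inj
    σ = proj₁ al
    sub : embed m≤n (pullback f inj A) ⊆ᴳ relabel σ A
    sub e′ e′∈ with image-elim ι ι-inj (pullback f inj A) e′ e′∈
    ... | e , e∈ , refl = subst (_∈ᴳ relabel σ A)
      (joins-unique
        (mapEdge-joins _ (perm-injective σ) (mapEdge-joins f inj (joins-self e)))
        (joins-cong (sym (proj₂ al (lo e))) (sym (proj₂ al (hi e))) (mapEdge-joins ι ι-inj (joins-self e))))
      (image-intro _ (perm-injective σ) A _ e∈)

-- Sparsity

card : (Fin n → Bool) → ℕ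
card {n} X = ∑ (ind ∘ X) (allFin n)

infix 25 _[_]

_[_] : Graph n → (Fin n → Bool) → Graph n
(G [ X ]) e = G e ∧ X (lo e) ∧ X (hi e)

[]-elim : (G : Graph n) (X : Fin n → Bool) (e : Edge n) →
          e ∈ᴳ G [ X ] → e ∈ᴳ G × X (lo e) ≡ true × X (hi e) ≡ true
[]-elim G X e e∈ = let p , q = ∧-true {G e} e∈ in p , ∧-true q

[]-intro : (G : Graph n) (X : Fin n → Bool) (e : Edge n) →
           e ∈ᴳ G → X (lo e) ≡ true → X (hi e) ≡ true → e ∈ᴳ G [ X ]
[]-intro G X e p q r = ∧-intro p (∧-intro q r)

[]-mono : (G H : Graph n) (X Y : Fin n → Bool) → G ⊆ᴳ H → (∀ x → X x ≡ true → Y x ≡ true) →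
          G [ X ] ⊆ᴳ H [ Y ]
[]-mono G H X Y G⊆H X⊆Y e e∈ = let p , q , r = []-elim G X e e∈ in
  []-intro H Y e (G⊆H e p) (X⊆Y _ q) (X⊆Y _ r)

joins∈[] : (G : Graph n) (X : Fin n → Bool) {a b : Fin n} {e : Edge n} → Joins a b e →
           e ∈ᴳ G → X a ≡ true → X b ≡ true → e ∈ᴳ G [ X ]
joins∈[] G X (fwd p) e∈ Xa Xb = []-intro G X _ e∈ Xa Xb
joins∈[] G X (bwd p) e∈ Xa Xb = []-intro G X _ e∈ Xb Xa

card-mono : (X Y : Fin n → Bool) → (∀ x → X x ≡ true → Y x ≡ true) → card X ≤ card Y
card-mono {n} X Y X⊆Y = ∑-mono (allFin n) λ x → ind-mono (X⊆Y x)

ind-submodular : ∀ {p q r s} → (p ≡ true → r ≡ true) → (q ≡ true → r ≡ true) →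
                 (p ≡ true → q ≡ true → s ≡ true) → ind p + ind q ≤ ind r + ind s
ind-submodular {true}  {true}  p⇒r q⇒r pq⇒s rewrite p⇒r refl | pq⇒s refl refl = ≤-refl
ind-submodular {true}  {false} p⇒r q⇒r pq⇒s rewrite p⇒r refl = s≤s z≤n
ind-submodular {false} {true}  p⇒r q⇒r pq⇒s rewrite q⇒r refl = s≤s z≤n
ind-submodular {false} {false} p⇒r q⇒r pq⇒s = z≤n

two-points : (X : Fin n → Bool) {a b : Fin n} → a ≢ b → X a ≡ true → X b ≡ true → 2 ≤ card X
two-points {n} X {a} {b} a≢b Xa Xb = begin
  2
    ≡⟨ cong₂ _+_ (sym (∑-fin-singleton a)) (sym (∑-fin-singleton b)) ⟩
  ∑ (λ x → ind (does (x ≟ a))) (allFin n) + ∑ (λ x → ind (does (x ≟ b))) (allFin n)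
    ≡⟨ sym (∑-+ _ _ (allFin n)) ⟩
  ∑ (λ x → ind (does (x ≟ a)) + ind (does (x ≟ b))) (allFin n)
    ≤⟨ ∑-mono (allFin n) pointwise ⟩
  card X ∎
  where
  open ≤-Reasoning
  pointwise : ∀ x → ind (does (x ≟ a)) + ind (does (x ≟ b)) ≤ ind (X x)
  pointwise x with x ≟ a | x ≟ b
  ... | yes refl | yes refl = contradiction refl a≢b
  ... | yes refl | no _     rewrite Xa = ≤-refl
  ... | no _     | yes refl rewrite Xb = ≤-refl
  ... | no _     | no _     = z≤n

∈[]⇒2≤ : (G : Graph n) (X : Fin n → Bool) (e : Edge n) → e ∈ᴳ G [ X ] → 2 ≤ card X
∈[]⇒2≤ G X e e∈ = let _ , p , q = []-elim G X e e∈ in two-points X (joins-≢ (joins-self e)) p q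

size-[]-small : (G : Graph n) (X : Fin n → Bool) → ¬ 2 ≤ card X → ∣ G [ X ] ∣ᴱ ≡ 0
size-[]-small G X small = size-zero (G [ X ]) λ e e∈ → small (∈[]⇒2≤ G X e e∈)

-- The bound of `RIndep` in additive form, free of truncated subtraction, and over Boolean
-- predicates so that unions and intersections are pointwise.
Sparse : Graph n → Set
Sparse {n} G = ∀ (X : Fin n → Bool) → 2 ≤ card X → ∣ G [ X ] ∣ᴱ + 3 ≤ 2 * card X

sparse-⊆ : (G H : Graph n) → G ⊆ᴳ H → Sparse H → Sparse G
sparse-⊆ G H G⊆H sparse X 2≤X =
  ≤-trans (ℕP.+-monoˡ-≤ 3 (size-mono (G [ X ]) (H [ X ]) ([]-mono G H X X G⊆H (λ _ p → p))))
          (sparse X 2≤X)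

-- Tight sets

-- Sparsity is the opposite inequality, so in a sparse graph this is equality for sets of at least
-- two vertices.
Tight : Graph n → (Fin n → Bool) → Set
Tight H X = 2 * card X ≤ ∣ H [ X ] ∣ᴱ + 3

_∪_ _∩_ : (Fin n → Bool) → (Fin n → Bool) → Fin n → Bool
(X ∪ Y) x = X x ∨ Y x
(X ∩ Y) x = X x ∧ Y x

card-∪-∩ : (X Y : Fin n → Bool) → card X + card Y ≡ card (X ∪ Y) + card (X ∩ Y)
card-∪-∩ {n} X Y = trans (sym (∑-+ _ _ (allFin n)))
  (trans (∑-cong (allFin n) λ x → pointwise (X x) (Y x)) (∑-+ _ _ (allFin n)))
  where
  pointwise : ∀ p q → ind p + ind q ≡ ind (p ∨ q) + ind (p ∧ q)
  pointwise true  true  = refl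
  pointwise true  false = refl
  pointwise false true  = refl
  pointwise false false = refl

size-supermodular : (H : Graph n) (X Y : Fin n → Bool) →
                    ∣ H [ X ] ∣ᴱ + ∣ H [ Y ] ∣ᴱ ≤ ∣ H [ X ∪ Y ] ∣ᴱ + ∣ H [ X ∩ Y ] ∣ᴱ
size-supermodular {n} H X Y
  rewrite size≡∑ (H [ X ]) | size≡∑ (H [ Y ]) | size≡∑ (H [ X ∪ Y ]) | size≡∑ (H [ X ∩ Y ]) =
  subst₂ _≤_ (∑-+ _ _ (allEdges n)) (∑-+ _ _ (allEdges n))
    (∑-mono (allEdges n) λ e → ind-submodular
      ([]-mono H H X (X ∪ Y) (λ _ p → p) (λ x → ∨-introˡ) e)
      ([]-mono H H Y (X ∪ Y) (λ _ p → p) (λ x → ∨-introʳ {X x}) e)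
      (λ p q → let h , x₁ , x₂ = []-elim H X e p ; _ , y₁ , y₂ = []-elim H Y e q in
        []-intro H (X ∩ Y) e h (∧-intro x₁ y₁) (∧-intro x₂ y₂)))

-- Uncrossing: vertex counts are modular and induced edge counts supermodular, so the bound of
-- sparsity on the intersection leaves no slack for the union.
tight-∪ : (H : Graph n) (X Y : Fin n → Bool) → Sparse H → Tight H X → Tight H Y →
          2 ≤ card (X ∩ Y) → Tight H (X ∪ Y)
tight-∪ H X Y sparse tX tY big = arith (card X) (card Y) (card (X ∪ Y)) (card (X ∩ Y))
  ∣ H [ X ] ∣ᴱ ∣ H [ Y ] ∣ᴱ ∣ H [ X ∪ Y ] ∣ᴱ ∣ H [ X ∩ Y ] ∣ᴱ
  (card-∪-∩ X Y) tX tY (size-supermodular H X Y) (sparse (X ∩ Y) big)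
  where
  open ≤-Reasoning
  arith : ∀ x y u i ex ey eu ei → x + y ≡ u + i → 2 * x ≤ ex + 3 → 2 * y ≤ ey + 3 →
          ex + ey ≤ eu + ei → ei + 3 ≤ 2 * i → 2 * u ≤ eu + 3
  arith x y u i ex ey eu ei x+y≡ hx hy he hi = ℕP.+-cancelʳ-≤ (2 * i) _ _ (begin
    2 * u + 2 * i         ≡⟨ sym (ℕP.*-distribˡ-+ 2 u i) ⟩
    2 * (u + i)           ≡⟨ cong (2 *_) (sym x+y≡) ⟩
    2 * (x + y)           ≡⟨ ℕP.*-distribˡ-+ 2 x y ⟩
    2 * x + 2 * y         ≤⟨ ℕP.+-mono-≤ hx hy ⟩
    (ex + 3) + (ey + 3)   ≡⟨ solve₁ ex ey ⟩
    (ex + ey) + 6         ≤⟨ ℕP.+-monoˡ-≤ 6 he ⟩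
    (eu + ei) + 6         ≡⟨ solve₂ eu ei ⟩
    (eu + 3) + (ei + 3)   ≤⟨ ℕP.+-monoʳ-≤ (eu + 3) hi ⟩
    (eu + 3) + 2 * i      ∎)
    where
    solve₁ : ∀ a b → (a + 3) + (b + 3) ≡ (a + b) + 6
    solve₁ = solve-∀
    solve₂ : ∀ a b → (a + b) + 6 ≡ (a + 3) + (b + 3)
    solve₂ = solve-∀

ind-disjoint₃ : ∀ {p q r u} → (p ≡ true → u ≡ true) → (q ≡ true → u ≡ true) → (r ≡ true → u ≡ true) →
                ¬ (p ≡ true × q ≡ true) → ¬ (q ≡ true × r ≡ true) → ¬ (p ≡ true × r ≡ true) →
                ind p + (ind q + ind r) ≤ ind u
ind-disjoint₃ {true}  {true}  {_}     _ _ _ ¬pq _ _ = contradiction (refl , refl) ¬pq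
ind-disjoint₃ {true}  {false} {true}  _ _ _ _ _ ¬pr = contradiction (refl , refl) ¬pr
ind-disjoint₃ {true}  {false} {false} p⇒u _ _ _ _ _ rewrite p⇒u refl = ≤-refl
ind-disjoint₃ {false} {true}  {true}  _ _ _ _ ¬qr _ = contradiction (refl , refl) ¬qr
ind-disjoint₃ {false} {true}  {false} _ q⇒u _ _ _ _ rewrite q⇒u refl = ≤-refl
ind-disjoint₃ {false} {false} {true}  _ _ r⇒u _ _ _ rewrite r⇒u refl = ≤-refl
ind-disjoint₃ {false} {false} {false} _ _ _ _ _ _ = z≤n

∑-+₃ : {A : Set} (f g h : A → ℕ) (xs : List A) →
       ∑ (λ x → f x + (g x + h x)) xs ≡ ∑ f xs + (∑ g xs + ∑ h xs)
∑-+₃ f g h xs = trans (∑-+ f _ xs) (cong (∑ f xs +_) (∑-+ g h xs))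

module _ {n : ℕ} (H : Graph n) (sparse : Sparse H) {a b c : Fin n}
  (a≢b : a ≢ b) (b≢c : b ≢ c) (a≢c : a ≢ c) (X Y Z : Fin n → Bool)
  (Xa : X a ≡ true) (Xb : X b ≡ true) (Yb : Y b ≡ true) (Yc : Y c ≡ true)
  (Za : Z a ≡ true) (Zc : Z c ≡ true) where

  private
    U : Fin n → Bool
    U x = X x ∨ (Y x ∨ Z x)

    common-edge : ∀ P Q e → ¬ 2 ≤ card (P ∩ Q) → ¬ (e ∈ᴳ H [ P ] × e ∈ᴳ H [ Q ])
    common-edge P Q e small (p , q) = small (∈[]⇒2≤ H (P ∩ Q) e
      (let h , x₁ , x₂ = []-elim H P e p ; _ , y₁ , y₂ = []-elim H Q e q in
        []-intro H (P ∩ Q) e h (∧-intro x₁ y₁) (∧-intro x₂ y₂)))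

    X⊆U : ∀ x → X x ≡ true → U x ≡ true
    X⊆U x = ∨-introˡ
    Y⊆U : ∀ x → Y x ≡ true → U x ≡ true
    Y⊆U x p = ∨-introʳ {X x} (∨-introˡ p)
    Z⊆U : ∀ x → Z x ≡ true → U x ≡ true
    Z⊆U x p = ∨-introʳ {X x} (∨-introʳ {Y x} p)

    -- Each of a, b, c lies in two of the three sets, so the sum counts it at least once too often.
    vertices : card U + 3 ≤ card X + (card Y + card Z)
    vertices = begin
      card U + 3
        ≡⟨ cong (card U +_) (sym (trans (∑-+₃ _ _ _ (allFin n))
             (cong₂ _+_ (∑-fin-singleton a) (cong₂ _+_ (∑-fin-singleton b) (∑-fin-singleton c))))) ⟩
      card U + ∑ at (allFin n)
        ≡⟨ sym (∑-+ (ind ∘ U) at (allFin n)) ⟩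
      ∑ (λ x → ind (U x) + at x) (allFin n)
        ≤⟨ ∑-mono (allFin n) pointwise ⟩
      ∑ (λ x → ind (X x) + (ind (Y x) + ind (Z x))) (allFin n)
        ≡⟨ ∑-+₃ _ _ _ (allFin n) ⟩
      card X + (card Y + card Z) ∎
      where
      open ≤-Reasoning
      at : Fin n → ℕ
      at x = ind (does (x ≟ a)) + (ind (does (x ≟ b)) + ind (does (x ≟ c)))
      pointwise : ∀ x → ind (U x) + at x ≤ ind (X x) + (ind (Y x) + ind (Z x))
      pointwise x with x ≟ a | x ≟ b | x ≟ c
      ... | yes refl | yes refl | _        = contradiction refl a≢b
      ... | yes refl | no _     | yes refl = contradiction refl a≢c
      ... | yes refl | no _     | no _ rewrite Xa | Za = s≤s (ℕP.m≤n+m 1 (ind (Y x)))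
      ... | no _     | yes refl | yes refl = contradiction refl b≢c
      ... | no _     | yes refl | no _ rewrite Xb | Yb = s≤s (s≤s z≤n)
      ... | no _     | no _     | yes refl rewrite Yc | Zc | ∨-introʳ {X x} {true} refl =
        ℕP.m≤n+m 2 (ind (X x))
      ... | no _     | no _     | no _ with X x | Y x | Z x
      ...   | true  | _     | _     = s≤s z≤n
      ...   | false | true  | _     = s≤s z≤n
      ...   | false | false | true  = s≤s z≤n
      ...   | false | false | false = z≤n

    -- Sets sharing at most one vertex share no induced edge, so edge counts add up. With
    -- `vertices`, 2(|U| + 3) is at most the edges of U plus 3·3, and the surplus 6 cancels.
    disjoint-union-tight : ¬ 2 ≤ card (X ∩ Y) → ¬ 2 ≤ card (Y ∩ Z) → ¬ 2 ≤ card (X ∩ Z) →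
                           Tight H X → Tight H Y → Tight H Z → Tight H U
    disjoint-union-tight ¬XY ¬YZ ¬XZ tX tY tZ = arith (card X) (card Y) (card Z) (card U)
      ∣ H [ X ] ∣ᴱ ∣ H [ Y ] ∣ᴱ ∣ H [ Z ] ∣ᴱ ∣ H [ U ] ∣ᴱ vertices tX tY tZ edges
      where
      edges : ∣ H [ X ] ∣ᴱ + (∣ H [ Y ] ∣ᴱ + ∣ H [ Z ] ∣ᴱ) ≤ ∣ H [ U ] ∣ᴱ
      edges rewrite size≡∑ (H [ X ]) | size≡∑ (H [ Y ]) | size≡∑ (H [ Z ]) | size≡∑ (H [ U ]) =
        ≤-trans (≤-reflexive (sym (∑-+₃ _ _ _ (allEdges n))))
          (∑-mono (allEdges n) λ e → ind-disjoint₃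
            ([]-mono H H X U (λ _ p → p) X⊆U e)
            ([]-mono H H Y U (λ _ p → p) Y⊆U e)
            ([]-mono H H Z U (λ _ p → p) Z⊆U e)
            (common-edge X Y e ¬XY) (common-edge Y Z e ¬YZ) (common-edge X Z e ¬XZ))
      open ≤-Reasoning
      arith : ∀ x y z u ex ey ez eu → u + 3 ≤ x + (y + z) →
              2 * x ≤ ex + 3 → 2 * y ≤ ey + 3 → 2 * z ≤ ez + 3 →
              ex + (ey + ez) ≤ eu → 2 * u ≤ eu + 3
      arith x y z u ex ey ez eu hu hx hy hz he = ℕP.+-cancelʳ-≤ 6 _ _ (begin
        2 * u + 6                             ≡⟨ sym (ℕP.*-distribˡ-+ 2 u 3) ⟩
        2 * (u + 3)                           ≤⟨ ℕP.*-monoʳ-≤ 2 hu ⟩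
        2 * (x + (y + z))                     ≡⟨ solve₁ x y z ⟩
        2 * x + (2 * y + 2 * z)               ≤⟨ ℕP.+-mono-≤ hx (ℕP.+-mono-≤ hy hz) ⟩
        (ex + 3) + ((ey + 3) + (ez + 3))      ≡⟨ solve₂ ex ey ez ⟩
        (ex + (ey + ez)) + 9                  ≤⟨ ℕP.+-monoˡ-≤ 9 he ⟩
        eu + 9                                ≡⟨ sym (ℕP.+-assoc eu 3 6) ⟩
        (eu + 3) + 6                          ∎)
        where
        solve₁ : ∀ a b c → 2 * (a + (b + c)) ≡ 2 * a + (2 * b + 2 * c)
        solve₁ = solve-∀
        solve₂ : ∀ a b c → (a + 3) + ((b + 3) + (c + 3)) ≡ (a + (b + c)) + 9
        solve₂ = solve-∀

  -- If two of the sets overlap in two vertices, their union is tight and already contains a, b, c;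
  -- otherwise the union of all three is tight. Either way a vertex outside all three stays outside.
  tight-triangle : Tight H X → Tight H Y → Tight H Z →
                   ∃ λ W → Tight H W × W a ≡ true × W b ≡ true × W c ≡ true ×
                     (∀ v → X v ≡ false → Y v ≡ false → Z v ≡ false → W v ≡ false)
  tight-triangle tX tY tZ with 2 ≤? card (X ∩ Y) | 2 ≤? card (Y ∩ Z) | 2 ≤? card (X ∩ Z)
  ... | yes big | _ | _ = X ∪ Y , tight-∪ H X Y sparse tX tY big
    , ∨-introˡ Xa , ∨-introˡ Xb , ∨-introʳ {X c} Yc , λ v p q _ → cong₂ _∨_ p q
  ... | no _ | yes big | _ = Y ∪ Z , tight-∪ H Y Z sparse tY tZ big
    , ∨-introʳ {Y a} Za , ∨-introˡ Yb , ∨-introˡ Yc , λ v _ p q → cong₂ _∨_ p q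
  ... | no _ | no _ | yes big = X ∪ Z , tight-∪ H X Z sparse tX tZ big
    , ∨-introˡ Xa , ∨-introˡ Xb , ∨-introʳ {X c} Zc , λ v p _ q → cong₂ _∨_ p q
  ... | no ¬XY | no ¬YZ | no ¬XZ = U , disjoint-union-tight ¬XY ¬YZ ¬XZ tX tY tZ
    , X⊆U a Xa , X⊆U b Xb , Y⊆U c Yc , λ v p q r → cong₂ _∨_ p (cong₂ _∨_ q r)

-- Vertices of low degree

star : Graph n → Fin n → Graph n
star G v e = G e ∧ inc v e

_∖_ : Graph n → Fin n → Graph n
(G ∖ v) e = G e ∧ not (inc v e)

∖-⊆ : (G : Graph n) (v : Fin n) → (G ∖ v) ⊆ᴳ G
∖-⊆ G v e e∈ = proj₁ (∧-true {G e} e∈)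

∖-avoids : (G : Graph n) (v : Fin n) → Avoids v (G ∖ v)
∖-avoids G v x e J e∈ = true≢false (joins⇒inc J) (not-true (proj₂ (∧-true {G e} e∈)))

∖-or-star : (G : Graph n) (v : Fin n) (e : Edge n) → e ∈ᴳ G → e ∈ᴳ (G ∖ v) ⊎ e ∈ᴳ star G v
∖-or-star G v e e∈ with ∈ᴳ? (λ f → inc v f) e
... | inj₁ at  = inj₂ (∧-intro e∈ at)
... | inj₂ off = inj₁ (∧-intro e∈ (not-intro off))

star-joins : (G : Graph n) (v : Fin n) (e : Edge n) → e ∈ᴳ star G v → ∃ λ x → Joins v x e
star-joins G v e e∈ = inc⇒joins (proj₂ (∧-true {G e} e∈))

handshake : (G : Graph n) → ∑ (λ v → ∣ star G v ∣ᴱ) (allFin n) ≤ 2 * ∣ G ∣ᴱ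
handshake {n} G = begin
  ∑ (λ v → ∣ star G v ∣ᴱ) (allFin n)
    ≡⟨ ∑-cong (allFin n) (λ v → size≡∑ (star G v)) ⟩
  ∑ (λ v → ∑ (λ e → ind (star G v e)) (allEdges n)) (allFin n)
    ≡⟨ ∑-swap (λ v e → ind (star G v e)) (allFin n) (allEdges n) ⟩
  ∑ (λ e → ∑ (λ v → ind (star G v e)) (allFin n)) (allEdges n)
    ≤⟨ ∑-mono (allEdges n) ends ⟩
  ∑ (λ e → 2 * ind (G e)) (allEdges n)
    ≡⟨ ∑-* 2 (ind ∘ G) (allEdges n) ⟩
  2 * ∑ (ind ∘ G) (allEdges n)
    ≡⟨ cong (2 *_) (sym (size≡∑ G)) ⟩
  2 * ∣ G ∣ᴱ ∎
  where
  open ≤-Reasoning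
  ends : ∀ e → ∑ (λ v → ind (star G v e)) (allFin n) ≤ 2 * ind (G e)
  ends e with G e
  ... | false = ≤-reflexive (∑-zero (allFin n))
  ... | true  = ≤-trans (∑-mono (allFin n) λ v → ind-∨ (does (v ≟ lo e)) (does (v ≟ hi e)))
    (≤-reflexive (trans (∑-+ _ _ (allFin n))
      (cong₂ _+_ (∑-fin-singleton (lo e)) (∑-fin-singleton (hi e)))))

SupportedIn : Graph n → (Fin n → Bool) → Set
SupportedIn G X = ∀ e → e ∈ᴳ G → X (lo e) ≡ true × X (hi e) ≡ true

supported-joins : (G : Graph n) (X : Fin n → Bool) → SupportedIn G X →
                  {a b : Fin n} {e : Edge n} → Joins a b e → e ∈ᴳ G → X a ≡ true × X b ≡ true
supported-joins G X supp (fwd p) e∈ = supp _ e∈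
supported-joins G X supp (bwd p) e∈ = let q , r = supp _ e∈ in r , q

-- Sparsity gives fewer than 2|X| edges, hence a degree sum below 4|X|. Comparing with the weight 4
-- on X and 0 elsewhere makes the vertex found lie in X as well.
low-degree : (G : Graph n) (X : Fin n → Bool) → Sparse G → SupportedIn G X → 1 ≤ card X →
             ∃ λ v → X v ≡ true × ∣ star G v ∣ᴱ ≤ 3
low-degree {n} G X sparse supp 1≤X =
  let v , lt = ∑-<⇒∃ {f = λ v → ∣ star G v ∣ᴱ} {λ v → 4 * ind (X v)} (allFin n) degrees
  in v , extract (X v) lt
  where
  open ≤-Reasoning
  extract : ∀ b {d} → d < 4 * ind b → b ≡ true × d ≤ 3
  extract true  (s≤s d≤3) = refl , d≤3
  extract false ()
  inside : ∣ G ∣ᴱ ≤ ∣ G [ X ] ∣ᴱ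
  inside = size-mono G (G [ X ]) λ e e∈ → let p , q = supp e e∈ in []-intro G X e e∈ p q
  few : 2 * ∣ G ∣ᴱ < 4 * card X
  few with 2 ≤? card X
  ... | yes 2≤X = begin-strict
    2 * ∣ G ∣ᴱ                <⟨ ℕP.*-monoʳ-< 2 (≤-trans (s≤s inside)
                                  (≤-trans (≤-reflexive (sym (ℕP.+-comm ∣ G [ X ] ∣ᴱ 1)))
                                    (≤-trans (ℕP.+-monoʳ-≤ ∣ G [ X ] ∣ᴱ (s≤s z≤n)) (sparse X 2≤X)))) ⟩
    2 * (2 * card X)          ≡⟨ sym (ℕP.*-assoc 2 2 (card X)) ⟩
    4 * card X                ∎
  ... | no small = begin-strict
    2 * ∣ G ∣ᴱ                ≤⟨ ℕP.*-monoʳ-≤ 2 (≤-trans inside (≤-reflexive (size-[]-small G X small))) ⟩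
    0                         <⟨ ≤-trans (s≤s z≤n) (ℕP.*-monoʳ-≤ 4 1≤X) ⟩
    4 * card X                ∎
  degrees : ∑ (λ v → ∣ star G v ∣ᴱ) (allFin n) < ∑ (λ v → 4 * ind (X v)) (allFin n)
  degrees = begin-strict
    ∑ (λ v → ∣ star G v ∣ᴱ) (allFin n)   ≤⟨ handshake G ⟩
    2 * ∣ G ∣ᴱ                           <⟨ few ⟩
    4 * card X                           ≡⟨ sym (∑-* 4 (ind ∘ X) (allFin n)) ⟩
    ∑ (λ v → 4 * ind (X v)) (allFin n)   ∎

_-ᴳ_ : Graph n → Edge n → Graph n
(G -ᴳ e) f = G f ∧ not (f =ᴱ e)

size--ᴳ : (G : Graph n) (e : Edge n) → e ∈ᴳ G → suc ∣ G -ᴳ e ∣ᴱ ≤ ∣ G ∣ᴱ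
size--ᴳ G e e∈ = ≤-trans
  (≤-reflexive (sym (size-+ᴳ (G -ᴳ e) e (≢true⇒false λ p →
    true≢false (=ᴱ-refl e) (not-true (proj₂ (∧-true {G e} p)))))))
  (size-mono ((G -ᴳ e) +ᴳ e) G (+ᴳ-⊆ (G -ᴳ e) G e (λ f p → proj₁ (∧-true {G f} p)) e∈))

-- Turns a degree bound into a list to match on, so that degrees 0 to 3 become four patterns;
-- distinctness of the edges will give distinct neighbours.
list-edges : ∀ k (S : Graph n) → ∣ S ∣ᴱ ≤ k →
             ∃ λ es → length es ≤ k × AllPairs _≢_ es × All (_∈ᴳ S) es × (∀ e → e ∈ᴳ S → e ∈ es)
list-edges k S S≤k with 1 ≤? ∣ S ∣ᴱ
... | no empty = [] , z≤n , [] , [] , λ e e∈ → contradiction (size-pos S e e∈) empty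
list-edges zero S S≤0 | yes 1≤S = contradiction (≤-trans 1≤S S≤0) λ ()
list-edges {n} (suc k) S S≤k | yes 1≤S
  with size-<⇒∃ {G = ∅ᴳ} {S} (≤-trans (s≤s (≤-reflexive (size-∅ {n}))) 1≤S)
... | e , e∈ , _ with list-edges k (S -ᴳ e) (s≤s⁻¹ (≤-trans (size--ᴳ S e e∈) S≤k))
...   | es , len , distinct , es⊆ , ⊆es =
  e ∷ es , s≤s len , All.map new es⊆ ∷ distinct , e∈ ∷ All.map old es⊆ , cover
  where
  new : ∀ {f} → f ∈ᴳ (S -ᴳ e) → e ≢ f
  new {f} p refl = true≢false (=ᴱ-refl f) (not-true (proj₂ (∧-true {S f} p)))
  old : ∀ {f} → f ∈ᴳ (S -ᴳ e) → f ∈ᴳ S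
  old {f} p = proj₁ (∧-true {S f} p)
  cover : ∀ f → f ∈ᴳ S → f ∈ e ∷ es
  cover f f∈ with ∈ᴳ? (_=ᴱ e) f
  ... | inj₁ eq  = here (=ᴱ⇒≡ f e eq)
  ... | inj₂ neq = there (⊆es f (∧-intro f∈ (not-intro neq)))

-- One-reductions

-- If `e` were already present, {a, b} itself would be tight. If `H +ᴳ e` broke sparsity on X, then
-- X would contain both ends, and X without v would be tight in `H`: v is isolated, so dropping it
-- loses no edge.
reduction : (H : Graph n) → Sparse H → {v a b : Fin n} {e : Edge n} → Joins a b e →
            v ≢ a → v ≢ b → Avoids v H →
            ¬ (∃ λ X → X a ≡ true × X b ≡ true × X v ≡ false × Tight H X) →
            H e ≡ false × Sparse (H +ᴳ e)
reduction {n} H sparse {v} {a} {b} {e} J v≢a v≢b av ¬tight = ≢true⇒false e∉ , sparse′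
  where
  pair : Fin n → Bool
  pair x = does (x ≟ a) ∨ does (x ≟ b)
  e∉ : ¬ e ∈ᴳ H
  e∉ e∈ = ¬tight (pair , pa , pb , cong₂ _∨_ (dec-false (v ≟ a) v≢a) (dec-false (v ≟ b) v≢b) , tight)
    where
    open ≤-Reasoning
    pa : pair a ≡ true
    pa = ∨-introˡ (dec-true (a ≟ a) refl)
    pb : pair b ≡ true
    pb = ∨-introʳ {does (b ≟ a)} (dec-true (b ≟ b) refl)
    card-pair : card pair ≤ 2
    card-pair = begin
      card pair
        ≤⟨ ∑-mono (allFin n) (λ x → ind-∨ (does (x ≟ a)) (does (x ≟ b))) ⟩
      ∑ (λ x → ind (does (x ≟ a)) + ind (does (x ≟ b))) (allFin n)
        ≡⟨ trans (∑-+ _ _ (allFin n)) (cong₂ _+_ (∑-fin-singleton a) (∑-fin-singleton b)) ⟩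
      2 ∎
    tight : Tight H pair
    -- Two vertices with one edge are tight: 2·2 = 1 + 3.
    tight = ≤-trans (ℕP.*-monoʳ-≤ 2 card-pair) (ℕP.+-monoˡ-≤ 3 {1}
      (size-pos (H [ pair ]) e (joins∈[] H pair J e∈ pa pb)))
  sparse′ : Sparse (H +ᴳ e)
  sparse′ X 2≤X with ∣ (H +ᴳ e) [ X ] ∣ᴱ + 3 ≤? 2 * card X
  ... | yes ok = ok
  -- The constant graph is merely a device for splitting on the Boolean `X a ∧ X b`.
  ... | no bad = ⊥-elim (split (∈ᴳ? (λ _ → X a ∧ X b) e))
    where
    X′ : Fin n → Bool
    X′ x = X x ∧ not (does (x ≟ v))
    X′-intro : ∀ x → X x ≡ true → x ≢ v → X′ x ≡ true
    X′-intro x Xx x≢v = ∧-intro Xx (not-intro (dec-false (x ≟ v) x≢v))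
    off-v : ∀ f → f ∈ᴳ (H +ᴳ e) [ X ] → f ∈ᴳ (H [ X′ ] +ᴳ e)
    off-v f f∈ = let p , q , r = []-elim (H +ᴳ e) X f f∈ in
      [ (λ f∈H → +ᴳ-old (H [ X′ ]) e f ([]-intro H X′ f f∈H
          (X′-intro _ q λ { refl → av _ f (joins-self f) f∈H })
          (X′-intro _ r λ { refl → av _ f (joins-sym (joins-self f)) f∈H })))
      , (λ { refl → +ᴳ-new (H [ X′ ]) f }) ]′ (+ᴳ-elim H e p)
    X′v : X′ v ≡ false
    X′v = trans (cong (λ z → X v ∧ not z) (dec-true (v ≟ v) refl)) (∧-false (X v))
      where
      ∧-false : ∀ x → x ∧ false ≡ false
      ∧-false true  = refl
      ∧-false false = refl
    tight : Tight H X′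
    tight = begin
      2 * card X′                           ≤⟨ ℕP.*-monoʳ-≤ 2 (card-mono X′ X λ x p → proj₁ (∧-true p)) ⟩
      2 * card X                            ≤⟨ s≤s⁻¹ (≤-trans (ℕP.≰⇒> bad) (≤-reflexive (ℕP.+-comm _ 3))) ⟩
      2 + ∣ (H +ᴳ e) [ X ] ∣ᴱ               ≤⟨ ℕP.+-monoʳ-≤ 2 (≤-trans
                                                 (size-mono ((H +ᴳ e) [ X ]) (H [ X′ ] +ᴳ e) off-v)
                                                 (size-+ᴳ-≤ (H [ X′ ]) e)) ⟩
      3 + ∣ H [ X′ ] ∣ᴱ                     ≡⟨ ℕP.+-comm 3 _ ⟩
      ∣ H [ X′ ] ∣ᴱ + 3                     ∎
      where open ≤-Reasoning
    split : X a ∧ X b ≡ true ⊎ X a ∧ X b ≡ false → ⊥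
    split (inj₁ both) = let Xa , Xb = ∧-true both in
      ¬tight (X′ , X′-intro a Xa (λ eq → v≢a (sym eq)) , X′-intro b Xb (λ eq → v≢b (sym eq)) , X′v , tight)
    split (inj₂ notboth) = bad (≤-trans (ℕP.+-monoˡ-≤ 3
      (size-mono ((H +ᴳ e) [ X ]) (H [ X ]) λ f f∈ →
        let p , q , r = []-elim (H +ᴳ e) X f f∈ in
        [ (λ f∈H → []-intro H X f f∈H q r)
        , (λ { refl → ⊥-elim (ends J q r) }) ]′ (+ᴳ-elim H e p))) (sparse X 2≤X))
      where
      ends : ∀ {f} → Joins a b f → X (lo f) ≡ true → X (hi f) ≡ true → ⊥
      ends (fwd p) q r = true≢false (∧-intro q r) notboth
      ends (bwd p) q r = true≢false (∧-intro r q) notboth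

-- With `W` tight, adding v would give |W| + 1 vertices and at least (2|W| - 3) + 3 edges, one more
-- than sparsity of `G` permits. The three edges are new because `H` avoids v.
degree-three-not-tight : (G H : Graph n) → Sparse G → H ⊆ᴳ G → {v a b c : Fin n} {e f g : Edge n} →
  Avoids v H → Joins v a e → Joins v b f → Joins v c g → e ≢ f → e ≢ g → f ≢ g →
  e ∈ᴳ G → f ∈ᴳ G → g ∈ᴳ G →
  ∀ W → W a ≡ true → W b ≡ true → W c ≡ true → W v ≡ false → ¬ Tight H W
degree-three-not-tight {n} G H sparse H⊆G {v} {a} {b} {c} {e} {f} {g} av Je Jf Jg e≢f e≢g f≢g e∈ f∈ g∈
  W Wa Wb Wc Wv tight = ℕP.1+n≰n (begin
    suc (2 * card W + 2)                  ≤⟨ s≤s (ℕP.+-monoˡ-≤ 2 tight) ⟩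
    suc (∣ H [ W ] ∣ᴱ + 3 + 2)            ≡⟨ arith ∣ H [ W ] ∣ᴱ ⟩
    3 + ∣ H [ W ] ∣ᴱ + 3                  ≡⟨ cong (_+ 3) (sym size₃) ⟩
    ∣ H₃ ∣ᴱ + 3                           ≤⟨ ℕP.+-monoˡ-≤ 3 (size-mono H₃ (G [ W⁺ ]) H₃⊆) ⟩
    ∣ G [ W⁺ ] ∣ᴱ + 3                     ≤⟨ sparse W⁺ (two-points W⁺ (joins-≢ Je) W⁺v (W⁺⊇ a Wa)) ⟩
    2 * card W⁺                           ≤⟨ ℕP.*-monoʳ-≤ 2 card-W⁺ ⟩
    2 * (card W + 1)                      ≡⟨ ℕP.*-distribˡ-+ 2 (card W) 1 ⟩
    2 * card W + 2                        ∎)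
  where
  open ≤-Reasoning
  arith : ∀ h → suc (h + 3 + 2) ≡ 3 + h + 3
  arith = solve-∀
  W⁺ : Fin n → Bool
  W⁺ x = W x ∨ does (x ≟ v)
  W⁺⊇ : ∀ x → W x ≡ true → W⁺ x ≡ true
  W⁺⊇ x = ∨-introˡ
  W⁺v : W⁺ v ≡ true
  W⁺v = ∨-introʳ {W v} (dec-true (v ≟ v) refl)
  card-W⁺ : card W⁺ ≤ card W + 1
  card-W⁺ = begin
    card W⁺
      ≤⟨ ∑-mono (allFin n) (λ x → ind-∨ (W x) (does (x ≟ v))) ⟩
    ∑ (λ x → ind (W x) + ind (does (x ≟ v))) (allFin n)
      ≡⟨ trans (∑-+ _ _ (allFin n)) (cong (card W +_) (∑-fin-singleton v)) ⟩
    card W + 1 ∎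
  H₁ H₂ H₃ : Graph n
  H₁ = H [ W ] +ᴳ e
  H₂ = H₁ +ᴳ f
  H₃ = H₂ +ᴳ g
  H₃⊆ : H₃ ⊆ᴳ G [ W⁺ ]
  H₃⊆ = +ᴳ-⊆ H₂ (G [ W⁺ ]) g (+ᴳ-⊆ H₁ (G [ W⁺ ]) f (+ᴳ-⊆ (H [ W ]) (G [ W⁺ ]) e
    ([]-mono H G W W⁺ H⊆G W⁺⊇)
    (joins∈[] G W⁺ Je e∈ W⁺v (W⁺⊇ a Wa)))
    (joins∈[] G W⁺ Jf f∈ W⁺v (W⁺⊇ b Wb)))
    (joins∈[] G W⁺ Jg g∈ W⁺v (W⁺⊇ c Wc))
  old∉ : ∀ {x h} → Joins v x h → ¬ h ∈ᴳ H [ W ]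
  old∉ J h∈ = av _ _ J (proj₁ ([]-elim H W _ h∈))
  size₃ : ∣ H₃ ∣ᴱ ≡ 3 + ∣ H [ W ] ∣ᴱ
  size₃ = trans (size-+ᴳ H₂ g (≢true⇒false λ p →
      [ [ old∉ Jg , (λ eq → e≢g (sym eq)) ]′ ∘ +ᴳ-elim (H [ W ]) e , (λ eq → f≢g (sym eq)) ]′ (+ᴳ-elim H₁ f p)))
    (cong suc (trans (size-+ᴳ H₁ f (≢true⇒false λ p →
      [ old∉ Jf , (λ eq → e≢f (sym eq)) ]′ (+ᴳ-elim (H [ W ]) e p)))
    (cong suc (size-+ᴳ (H [ W ]) e (≢true⇒false (old∉ Je))))))

module Rigidity (F : RigidityFamily2) where
  open Family (family F)

  Mat : (n : ℕ) → Matroid n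
  Mat = M (family F)

  -- Zero-extensions

  punchIn-inj : (v : Fin (suc n)) → Injective (punchIn v)
  punchIn-inj v {x} {y} = FinP.punchIn-injective v x y

  -- A graph avoiding v lives on the other n vertices, included by `punchIn v`, where the rank is
  -- smaller by 2.
  avoiding-rank : 2 ≤ n → {v : Fin (suc n)} (A : Graph (suc n)) →
                  Avoids v A → Indep (Mat (suc n)) A → ∣ A ∣ᴱ ≤ 2 * n ∸ 3
  avoiding-rank {n} 2≤n {v} A av iA = ≤-trans
    (size-pullback (punchIn v) (punchIn-inj v) A onto)
    (proj₂ (rank F n 2≤n) _ (indep-pullback (punchIn v) (punchIn-inj v) 2≤n iA))
    where
    onto : ∀ e → e ∈ᴳ A → ∃ λ e₀ → mapEdge (punchIn v) (punchIn-inj v) e₀ ≡ e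
    onto e e∈ with mapEdge-preimage (punchIn v) (punchIn-inj v)
      (joins-cong (sym (FinP.punchIn-punchOut v≢lo)) (sym (FinP.punchIn-punchOut v≢hi)) (joins-self e))
      where
      v≢lo : v ≢ lo e
      v≢lo refl = av _ e (joins-self e) e∈
      v≢hi : v ≢ hi e
      v≢hi refl = av _ e (joins-sym (joins-self e)) e∈
    ... | e₀ , _ , eq = e₀ , eq

  avoiding-basis : 2 ≤ n → (v : Fin (suc n)) →
                   ∃ λ B → Avoids v B × Indep (Mat (suc n)) B × 2 * n ∸ 3 ≤ ∣ B ∣ᴱ
  avoiding-basis {n} 2≤n v with proj₁ (rank F n 2≤n)
  ... | B , iB , ∣B∣≡ = image (punchIn v) (punchIn-inj v) B , av
    , indep-image (punchIn v) (punchIn-inj v) 2≤n iB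
    , ≤-trans (≤-reflexive (sym ∣B∣≡)) (size-image (punchIn v) (punchIn-inj v) B)
    where
    av : Avoids v (image (punchIn v) (punchIn-inj v) B)
    av x e J e∈ with image-elim (punchIn v) (punchIn-inj v) B e e∈
    ... | e₀ , _ , refl
      with joins-ends J (mapEdge-joins (punchIn v) (punchIn-inj v) (joins-self e₀))
    ...   | inj₁ (eq , _) = FinP.punchInᵢ≢i v (lo e₀) (sym eq)
    ...   | inj₂ (eq , _) = FinP.punchInᵢ≢i v (hi e₀) (sym eq)

  record TwoAt (v : Fin n) (A D : Graph n) : Set where
    field
      {c d} : Fin n
      {g h} : Edge n
      joins-g : Joins v c g
      joins-h : Joins v d h
      g≢h : g ≢ h
      g∈D : g ∈ᴳ D
      h∈D : h ∈ᴳ D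
      g∉A : A g ≡ false
      h∉A : A h ≡ false
      indep : Indep (Mat n) ((A +ᴳ g) +ᴳ h)

  -- `D` is larger than `A` by at least two, so augmentation applies twice. A new edge missing v
  -- would give an independent set avoiding v beyond `avoiding-rank`; for the second edge this is
  -- applied to `A +ᴳ h`, a subset of the final set.
  two-at : 2 ≤ n → {v : Fin (suc n)} (A D : Graph (suc n)) → Avoids v A →
           Indep (Mat (suc n)) A → 2 * n ∸ 3 ≤ ∣ A ∣ᴱ →
           Indep (Mat (suc n)) D → 2 + (2 * n ∸ 3) ≤ ∣ D ∣ᴱ → TwoAt v A D
  two-at {n} 2≤n {v} A D av iA A-large iD D-large
    with indep-aug (Mat (suc n)) iA iD
           (≤-trans (s≤s (≤-trans (avoiding-rank 2≤n A av iA) (ℕP.n≤1+n _))) D-large)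
  ... | g , g∈D , g∉A , iAg with indep-aug (Mat (suc n)) iAg iD
           (≤-trans (s≤s (≤-trans (≤-reflexive (size-+ᴳ A g g∉A))
              (s≤s (avoiding-rank 2≤n A av iA)))) D-large)
  ...   | h , h∈D , h∉ , iAgh = record
    { joins-g = proj₂ (at-v g g∉A iAg)
    ; joins-h = proj₂ (at-v h (proj₁ h∉′) (indep-sub (Mat (suc n)) Ah⊆ iAgh))
    ; g≢h = λ eq → proj₂ h∉′ (sym eq)
    ; g∈D = g∈D ; h∈D = h∈D ; g∉A = g∉A ; h∉A = proj₁ h∉′ ; indep = iAgh }
    where
    h∉′ = ∉+ᴳ A g h∉
    Ah⊆ : (A +ᴳ h) ⊆ᴳ ((A +ᴳ g) +ᴳ h)
    Ah⊆ = +ᴳ-⊆ A _ h (+ᴳ²-old A g h) (+ᴳ-new (A +ᴳ g) h)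
    at-v : ∀ e → A e ≡ false → Indep (Mat (suc n)) (A +ᴳ e) → ∃ λ x → Joins v x e
    at-v e e∉ i with inc v e in eq
    ... | true  = inc⇒joins eq
    ... | false = contradiction
      (≤-trans (≤-reflexive (sym (size-+ᴳ A e e∉)))
        (≤-trans (avoiding-rank 2≤n (A +ᴳ e) (avoids-+ᴳ-inc A e av eq) i) A-large))
      ℕP.1+n≰n

  maximal-avoiding : 2 ≤ n → (v : Fin (suc n)) (H : Graph (suc n)) →
                     Avoids v H → Indep (Mat (suc n)) H →
                     ∃ λ A → H ⊆ᴳ A × Avoids v A × Indep (Mat (suc n)) A × 2 * n ∸ 3 ≤ ∣ A ∣ᴱ
  maximal-avoiding {n} 2≤n v H avH iH with avoiding-basis 2≤n v
  ... | B , avB , iB , B-large with extend (Mat (suc n)) iH iB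
  ...   | A , H⊆A , A⊆ , iA , B≤A =
    A , H⊆A , (λ x e J e∈ → [ avH x e J , avB x e J ]′ (A⊆ e e∈)) , iA , ≤-trans B-large B≤A

  large-basis : 2 ≤ n → ∃ λ D → Indep (Mat (suc n)) D × 2 + (2 * n ∸ 3) ≤ ∣ D ∣ᴱ
  large-basis {n} 2≤n with proj₁ (rank F (suc n) (≤-trans 2≤n (ℕP.n≤1+n n)))
  ... | D , iD , ∣D∣≡ = D , iD , ≤-reflexive (trans (rank-suc n 2≤n) (sym ∣D∣≡))
    where
    -- The increment is exactly 2 because the truncated subtraction is exact once n is at least 2.
    rank-suc : ∀ n → 2 ≤ n → 2 + (2 * n ∸ 3) ≡ 2 * suc n ∸ 3
    rank-suc n 2≤n = sym (trans (cong (_∸ 3) (ℕP.*-suc 2 n))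
      (ℕP.+-∸-assoc 2 {2 * n} {3} (≤-trans (s≤s (s≤s (s≤s z≤n))) (ℕP.*-monoʳ-≤ 2 2≤n))))

  -- As σ fixes v, an edge at v comes from an edge at v, and `g`, `h` are the only candidates since
  -- `A` avoids v.
  relabel-at : (σ : Permutation′ n) {v a b c d : Fin n} {e f g h : Edge n} (A : Graph n) →
               σ ⟨$⟩ʳ v ≡ v → σ ⟨$⟩ʳ c ≡ a → σ ⟨$⟩ʳ d ≡ b → Avoids v A →
               Joins v a e → Joins v b f → Joins v c g → Joins v d h →
               ∀ x y → Joins v x y → y ∈ᴳ relabel σ ((A +ᴳ g) +ᴳ h) → y ≡ e ⊎ y ≡ f
  relabel-at {n} σ {v} {e = e} {f} {g} {h} A σv σc σd avA Je Jf Jg Jh x y J y∈ =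
    go (image-elim _ (perm-injective σ) ((A +ᴳ g) +ᴳ h) y y∈)
    where
    σᴱ : Edge n → Edge n
    σᴱ = mapEdge _ (perm-injective σ)
    go : (∃ λ y₀ → y₀ ∈ᴳ ((A +ᴳ g) +ᴳ h) × σᴱ y₀ ≡ y) → y ≡ e ⊎ y ≡ f
    go (y₀ , y₀∈ , eq) = [ [ old , at-g ]′ ∘ +ᴳ-elim A g , at-h ]′ (+ᴳ-elim (A +ᴳ g) h y₀∈)
      where
      at-g : y₀ ≡ g → y ≡ e ⊎ y ≡ f
      at-g refl = inj₁ (trans (sym eq)
        (joins-unique (joins-cong σv σc (mapEdge-joins _ (perm-injective σ) Jg)) Je))
      at-h : y₀ ≡ h → y ≡ e ⊎ y ≡ f
      at-h refl = inj₂ (trans (sym eq)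
        (joins-unique (joins-cong σv σd (mapEdge-joins _ (perm-injective σ) Jh)) Jf))
      old : y₀ ∈ᴳ A → y ≡ e ⊎ y ≡ f
      old y₀∈A =
        let y₁ , J₁ , eq₁ = mapEdge-preimage _ (perm-injective σ) {v} {σ ⟨$⟩ˡ x}
                              (joins-cong (sym σv) (sym (inverseʳ σ)) J)
            y₁≡y₀ = mapEdge-injective _ (perm-injective σ) {y₁} {y₀} (trans eq₁ (sym eq))
        in ⊥-elim (avA _ y₀ (subst (Joins _ _) y₁≡y₀ J₁) y₀∈A)

  -- A maximal independent set avoiding v extends to a basis by two edges at v;
  -- a vertex permutation fixing v moves them to any two prescribed edges at v.
  zero-extension : 2 ≤ n → {v a b : Fin (suc n)} {e f : Edge (suc n)} →
                   Joins v a e → Joins v b f → a ≢ b → (H : Graph (suc n)) →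
                   Avoids v H → Indep (Mat (suc n)) H → Indep (Mat (suc n)) ((H +ᴳ e) +ᴳ f)
  zero-extension {n} 2≤n {v} {a} {b} {e} {f} Je Jf a≢b H avH iH =
    step₁ (maximal-avoiding 2≤n v H avH iH) (large-basis 2≤n)
    where
    Goal : Set
    Goal = Indep (Mat (suc n)) ((H +ᴳ e) +ᴳ f)

    step₃ : (A D : Graph (suc n)) → H ⊆ᴳ A → TwoAt v A D →
            (∀ x y → Joins v x y → y ∈ᴳ D → y ≡ e ⊎ y ≡ f) → Goal
    step₃ A D H⊆A T at-v = indep-sub (Mat (suc n)) sub indep
      where
      open TwoAt T
      g∈ = +ᴳ²-new₁ A g h
      h∈ = +ᴳ²-new₂ A g h
      both : g ≡ e ⊎ g ≡ f → h ≡ e ⊎ h ≡ f → e ∈ᴳ ((A +ᴳ g) +ᴳ h) × f ∈ᴳ ((A +ᴳ g) +ᴳ h)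
      both (inj₁ p) (inj₁ q) = contradiction (trans p (sym q)) g≢h
      both (inj₂ p) (inj₂ q) = contradiction (trans p (sym q)) g≢h
      both (inj₁ refl) (inj₂ refl) = g∈ , h∈
      both (inj₂ refl) (inj₁ refl) = h∈ , g∈
      ef∈ = both (at-v _ g joins-g g∈D) (at-v _ h joins-h h∈D)
      sub : ((H +ᴳ e) +ᴳ f) ⊆ᴳ ((A +ᴳ g) +ᴳ h)
      sub = +ᴳ-⊆ (H +ᴳ e) _ f
        (+ᴳ-⊆ H _ e (λ x p → +ᴳ²-old A g h x (H⊆A x p)) (proj₁ ef∈)) (proj₂ ef∈)

    step₂ : (A D : Graph (suc n)) → H ⊆ᴳ A → Avoids v A → Indep (Mat (suc n)) A →
            2 * n ∸ 3 ≤ ∣ A ∣ᴱ → TwoAt v A D → Goal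
    -- σ also moves `A`, so the relabelled set need not contain `A`. It serves instead as the larger
    -- set in a second augmentation of the original `A`, and its only possible edges at v are `e`
    -- and `f`.
    step₂ A D H⊆A avA iA A-large T = step₃ A (relabel σ D₀) H⊆A
      (two-at 2≤n A (relabel σ D₀) avA iA A-large
        (relabel-inv (family F) (suc n) σ D₀ indep)
        (≤-trans D₀-large (size-image _ (perm-injective σ) D₀)))
      (relabel-at σ A (σ-maps zero) (σ-maps (suc zero)) (σ-maps (suc (suc zero)))
        avA Je Jf joins-g joins-h)
      where
      open TwoAt T
      D₀ = (A +ᴳ g) +ᴳ h
      D₀-large : 2 + (2 * n ∸ 3) ≤ ∣ D₀ ∣ᴱ
      D₀-large = ≤-trans (s≤s (s≤s A-large)) (≤-reflexive (sym
        (trans (size-+ᴳ (A +ᴳ g) h (≢true⇒false λ h∈ →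
                 [ (λ p → true≢false p h∉A) , (λ eq → g≢h (sym eq)) ]′ (+ᴳ-elim A g h∈)))
               (cong suc (size-+ᴳ A g g∉A)))))
      c≢d : c ≢ d
      c≢d eq = g≢h (joins-unique joins-g (joins-cong refl (sym eq) joins-h))
      triple-inj : {p q : Fin (suc n)} → v ≢ p → v ≢ q → p ≢ q →
                   Injective (Vec.lookup (v ∷ p ∷ q ∷ []))
      triple-inj v≢p v≢q p≢q {i} {j} = VecU.lookup-injective
        ((v≢p ∷ v≢q ∷ []) ∷ (p≢q ∷ []) ∷ [] ∷ []) i j
      al = aligning (Vec.lookup (v ∷ c ∷ d ∷ [])) (Vec.lookup (v ∷ a ∷ b ∷ []))
             (triple-inj (joins-≢ joins-g) (joins-≢ joins-h) c≢d)
             (triple-inj (joins-≢ Je) (joins-≢ Jf) a≢b)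
      σ = proj₁ al
      σ-maps = proj₂ al

    step₁ : (∃ λ A → H ⊆ᴳ A × Avoids v A × Indep (Mat (suc n)) A × 2 * n ∸ 3 ≤ ∣ A ∣ᴱ) →
            (∃ λ D → Indep (Mat (suc n)) D × 2 + (2 * n ∸ 3) ≤ ∣ D ∣ᴱ) → Goal
    step₁ (A , H⊆A , avA , iA , A-large) (D , iD , D-large) =
      step₂ A D H⊆A avA iA A-large (two-at 2≤n A D avA iA A-large iD D-large)

  -- One-extensions

  crossing : Fin 3 → Fin 3 → Edge 6
  crossing i j = edge (i ↑ˡ 3) (3 ↑ʳ j) (subst₂ _<_ (sym (FinP.toℕ-↑ˡ i 3)) (sym (FinP.toℕ-↑ʳ 3 j))
    (≤-trans (FinP.toℕ<n i) (ℕP.m≤m+n 3 (Fin.toℕ j))))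

  crossing-joins : ∀ i j → Joins (i ↑ˡ 3) (3 ↑ʳ j) (crossing i j)
  crossing-joins i j = joins-self (crossing i j)

  K33-crossing : ∀ e → e ∈ᴳ K33 → ∃₂ λ i j → e ≡ crossing i j
  K33-crossing (edge a b a<b) e∈ with ∧-true e∈
  ... | p , q with low a p | high b q
    where
    low : ∀ (a : Fin 6) → (Fin.toℕ a ℕ.<ᵇ 3) ≡ true → ∃ λ i → a ≡ i ↑ˡ 3
    low zero                _ = zero , refl
    low (suc zero)          _ = suc zero , refl
    low (suc (suc zero))    _ = suc (suc zero) , refl
    low (suc (suc (suc _))) ()
    high : ∀ (b : Fin 6) → (3 ℕ.≤ᵇ Fin.toℕ b) ≡ true → ∃ λ j → b ≡ 3 ↑ʳ j
    high zero                ()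
    high (suc zero)          ()
    high (suc (suc zero))    ()
    high (suc (suc (suc j))) _ = j , refl
  ...   | i , a≡ | j , b≡ = i , j , edge-≡ a≡ b≡

  low≢high : ∀ (i j : Fin 3) → i ↑ˡ 3 ≢ 3 ↑ʳ j
  low≢high i j eq = ℕP.<-irrefl (trans (sym (FinP.toℕ-↑ˡ i 3)) (cong Fin.toℕ eq))
    (≤-trans (FinP.toℕ<n i) (≤-trans (ℕP.m≤m+n 3 (Fin.toℕ j))
      (≤-reflexive (sym (FinP.toℕ-↑ʳ 3 j)))))

  e₀₁ : Edge 6
  e₀₁ = edge zero (suc zero) (s≤s z≤n)

  -- Ten edges against rank nine, both found by evaluation.
  K33+e₀₁-dependent : ¬ Indep (Mat 6) (K33 +ᴳ e₀₁)
  K33+e₀₁-dependent i = ℕP.1+n≰n (proj₂ (rank F 6 (s≤s (s≤s z≤n))) (K33 +ᴳ e₀₁) i)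

  -- `φ` sends 0, 1, 2 to the neighbours a, b, c and 3, 4, 5 to the three copies of the removed
  -- vertex, so that crossings become spokes and `e₀₁` becomes the base ab.
  module OneExtension {n : ℕ} (2≤n : 2 ≤ n) (K33-indep : Indep (Mat 6) K33)
    (φ : Fin 6 → Fin (suc n)) (φ-inj : Injective φ) (H : Graph (suc n))
    (avoids : ∀ j → Avoids (φ (3 ↑ʳ j)) H)
    (base∉ : H (mapEdge φ φ-inj e₀₁) ≡ false)
    (base-indep : Indep (Mat (suc n)) (H +ᴳ mapEdge φ φ-inj e₀₁)) where

    base : Edge (suc n)
    base = mapEdge φ φ-inj e₀₁

    spoke : Fin 3 → Fin 3 → Edge (suc n)
    spoke i j = mapEdge φ φ-inj (crossing i j)

    base-joins : Joins (φ zero) (φ (suc zero)) base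
    base-joins = mapEdge-joins φ φ-inj (fwd (s≤s z≤n))

    spoke-joins : ∀ i j → Joins (φ (i ↑ˡ 3)) (φ (3 ↑ʳ j)) (spoke i j)
    spoke-joins i j = mapEdge-joins φ φ-inj (crossing-joins i j)

    extended : Fin 3 → Graph (suc n)
    extended j = ((H +ᴳ spoke zero j) +ᴳ spoke (suc zero) j) +ᴳ spoke (suc (suc zero)) j

    two-spokes : Fin 3 → Graph (suc n) → Graph (suc n)
    two-spokes j G = (G +ᴳ spoke zero j) +ᴳ spoke (suc zero) j

    two-spokes-⊆ : ∀ j G → G ⊆ᴳ two-spokes j G
    two-spokes-⊆ j G = +ᴳ²-old G (spoke zero j) (spoke (suc zero) j)

    two-spokes-elim : ∀ j G e → e ∈ᴳ two-spokes j G → e ∈ᴳ G ⊎ ∃ λ i → e ≡ spoke i j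
    two-spokes-elim j G e e∈ with +ᴳ-elim (G +ᴳ spoke zero j) _ e∈
    ... | inj₂ q = inj₂ (suc zero , q)
    ... | inj₁ p with +ᴳ-elim G _ p
    ...   | inj₁ q = inj₁ q
    ...   | inj₂ q = inj₂ (zero , q)

    two-spokes-indep : ∀ j G → Avoids (φ (3 ↑ʳ j)) G → Indep (Mat (suc n)) G →
                       Indep (Mat (suc n)) (two-spokes j G)
    two-spokes-indep j G av iG = zero-extension 2≤n
      (joins-sym (spoke-joins zero j)) (joins-sym (spoke-joins (suc zero) j))
      (λ eq → contradiction (φ-inj eq) λ ()) G av iG

    two-spokes-avoids : ∀ j k G → k ≢ j → Avoids (φ (3 ↑ʳ k)) G →
                        Avoids (φ (3 ↑ʳ k)) (two-spokes j G)
    two-spokes-avoids j k G k≢j av =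
      avoids-+ᴳ (G +ᴳ spoke zero j)
        (avoids-+ᴳ G av (spoke-joins zero j) (off zero) off′)
        (spoke-joins (suc zero) j) (off (suc zero)) off′
      where
      off : ∀ i → φ (3 ↑ʳ k) ≢ φ (i ↑ˡ 3)
      off i eq = low≢high i k (sym (φ-inj eq))
      off′ : φ (3 ↑ʳ k) ≢ φ (3 ↑ʳ j)
      off′ eq = k≢j (FinP.↑ʳ-injective 3 k j (φ-inj eq))

    spokes₀ spokes₁ all-spokes : Graph (suc n) → Graph (suc n)
    spokes₀ G    = two-spokes zero G
    spokes₁ G    = two-spokes (suc zero) (spokes₀ G)
    all-spokes G = two-spokes (suc (suc zero)) (spokes₁ G)

    spokes₁-⊆ : ∀ G → spokes₁ G ⊆ᴳ all-spokes G
    spokes₁-⊆ G = two-spokes-⊆ (suc (suc zero)) (spokes₁ G)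

    spokes₀-⊆ : ∀ G → spokes₀ G ⊆ᴳ all-spokes G
    spokes₀-⊆ G e p = spokes₁-⊆ G e (two-spokes-⊆ (suc zero) (spokes₀ G) e p)

    all-spokes-⊆ : ∀ G → G ⊆ᴳ all-spokes G
    all-spokes-⊆ G e p = spokes₀-⊆ G e (two-spokes-⊆ zero G e p)

    all-spokes₀ : ∀ G j → spoke zero j ∈ᴳ all-spokes G
    all-spokes₀ G zero             = spokes₀-⊆ G (spoke zero zero) (+ᴳ²-new₁ G _ (spoke (suc zero) zero))
    all-spokes₀ G (suc zero)       = spokes₁-⊆ G (spoke zero (suc zero))
      (+ᴳ²-new₁ (spokes₀ G) _ (spoke (suc zero) (suc zero)))
    all-spokes₀ G (suc (suc zero)) =
      +ᴳ²-new₁ (spokes₁ G) _ (spoke (suc zero) (suc (suc zero)))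

    all-spokes₁ : ∀ G j → spoke (suc zero) j ∈ᴳ all-spokes G
    all-spokes₁ G zero             = spokes₀-⊆ G (spoke (suc zero) zero) (+ᴳ²-new₂ G (spoke zero zero) _)
    all-spokes₁ G (suc zero)       = spokes₁-⊆ G (spoke (suc zero) (suc zero))
      (+ᴳ²-new₂ (spokes₀ G) (spoke zero (suc zero)) _)
    all-spokes₁ G (suc (suc zero)) =
      +ᴳ²-new₂ (spokes₁ G) (spoke zero (suc (suc zero))) _

    all-spokes-elim : ∀ G e → e ∈ᴳ all-spokes G → e ∈ᴳ G ⊎ ∃₂ λ i j → e ≡ spoke i j
    all-spokes-elim G e e∈ with two-spokes-elim _ (spokes₁ G) e e∈
    ... | inj₂ (i , eq) = inj₂ (i , _ , eq)
    ... | inj₁ p with two-spokes-elim _ (spokes₀ G) e p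
    ...   | inj₂ (i , eq) = inj₂ (i , _ , eq)
    ...   | inj₁ q with two-spokes-elim _ G e q
    ...     | inj₂ (i , eq) = inj₂ (i , _ , eq)
    ...     | inj₁ r = inj₁ r

    J J⁺ : Graph (suc n)
    J  = all-spokes H
    J⁺ = all-spokes (H +ᴳ base)

    J⁺-indep : Indep (Mat (suc n)) J⁺
    J⁺-indep =
      two-spokes-indep (suc (suc zero)) _
        (two-spokes-avoids (suc zero) _ _ (λ ())
          (two-spokes-avoids zero _ _ (λ ()) (base-avoids (suc (suc zero)))))
        (two-spokes-indep (suc zero) _
          (two-spokes-avoids zero _ _ (λ ()) (base-avoids (suc zero)))
          (two-spokes-indep zero _ (base-avoids zero) base-indep))
      where
      base-avoids : ∀ j → Avoids (φ (3 ↑ʳ j)) (H +ᴳ base)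
      base-avoids j = avoids-+ᴳ H (avoids j) base-joins
        (λ eq → contradiction (φ-inj eq) (λ ())) (λ eq → contradiction (φ-inj eq) (λ ()))

    base∉spokes : ∀ i j → base ≢ spoke i j
    base∉spokes i j eq with joins-ends (subst (Joins _ _) eq base-joins) (spoke-joins i j)
    ... | inj₁ (_ , q) = contradiction (φ-inj q) λ ()
    ... | inj₂ (q , _) = contradiction (φ-inj q) λ ()

    J⊆J⁺ : J ⊆ᴳ J⁺
    J⊆J⁺ = mono (suc (suc zero)) (spokes₁ H) (spokes₁ (H +ᴳ base))
      (mono (suc zero) (spokes₀ H) (spokes₀ (H +ᴳ base)) (mono zero H (H +ᴳ base) (+ᴳ-old H base)))
      where
      mono : ∀ j G G′ → G ⊆ᴳ G′ → two-spokes j G ⊆ᴳ two-spokes j G′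
      mono j G G′ G⊆G′ = +ᴳ-mono (G +ᴳ spoke zero j) (G′ +ᴳ spoke zero j) (spoke (suc zero) j)
        (+ᴳ-mono G G′ (spoke zero j) G⊆G′)

    J<J⁺ : ∣ J ∣ᴱ < ∣ J⁺ ∣ᴱ
    J<J⁺ = ≤-trans (≤-reflexive (sym (size-+ᴳ J base base∉J)))
      (size-mono (J +ᴳ base) J⁺ (+ᴳ-⊆ J J⁺ base J⊆J⁺ (all-spokes-⊆ (H +ᴳ base) base (+ᴳ-new H base))))
      where
      base∉J : J base ≡ false
      base∉J = ≢true⇒false λ b∈ → [ (λ p → true≢false p base∉)
                                  , (λ (i , j , eq) → base∉spokes i j eq) ]′ (all-spokes-elim H base b∈)

    -- The transposition of two copies fixes a, b, c and, both copies being isolated in `H`, every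
    -- edge of `H`; it only exchanges the spokes.
    extended-swap : ∀ j → Indep (Mat (suc n)) (extended j) → Indep (Mat (suc n)) (extended zero)
    extended-swap j i = indep-sub (Mat (suc n)) sub (relabel-inv (family F) (suc n) σ (extended j) i)
      where
      v w : Fin (suc n)
      v = φ (3 ↑ʳ zero)
      w = φ (3 ↑ʳ j)
      σ = transpose v w
      G′ = relabel σ (extended j)
      σ-fixes : ∀ {x} → x ≢ v → x ≢ w → σ ⟨$⟩ʳ x ≡ x
      σ-fixes = transpose-other
      low-≢ : ∀ i k → φ (i ↑ˡ 3) ≢ φ (3 ↑ʳ k)
      low-≢ i k eq = low≢high i k (φ-inj eq)
      moved : ∀ e e′ {a b a′ b′} → Joins a b e → Joins a′ b′ e′ → σ ⟨$⟩ʳ a ≡ a′ → σ ⟨$⟩ʳ b ≡ b′ →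
              e ∈ᴳ extended j → e′ ∈ᴳ G′
      moved e e′ Je Je′ σa σb e∈ = subst (_∈ᴳ G′)
        (joins-unique (joins-cong σa σb (mapEdge-joins _ (perm-injective σ) Je)) Je′)
        (image-intro _ (perm-injective σ) (extended j) e e∈)
      kept : H ⊆ᴳ G′
      kept e e∈ = moved e e (joins-self e) (joins-self e)
        (σ-fixes (λ { eq → avoids zero _ e (joins-cong eq refl (joins-self e)) e∈ })
                 (λ { eq → avoids j _ e (joins-cong eq refl (joins-self e)) e∈ }))
        (σ-fixes (λ { eq → avoids zero _ e (joins-cong eq refl (joins-sym (joins-self e))) e∈ })
                 (λ { eq → avoids j _ e (joins-cong eq refl (joins-sym (joins-self e))) e∈ }))
        (+ᴳ-old (two-spokes j H) (spoke (suc (suc zero)) j) e (two-spokes-⊆ j H e e∈))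
      spoke-moved : ∀ i → spoke i j ∈ᴳ extended j → spoke i zero ∈ᴳ G′
      spoke-moved i = moved _ _ (spoke-joins i j) (spoke-joins i zero)
        (σ-fixes (low-≢ i zero) (low-≢ i j)) (transposeʳ v w)
      sub : extended zero ⊆ᴳ G′
      sub = +ᴳ-⊆ (two-spokes zero H) G′ (spoke (suc (suc zero)) zero)
        (+ᴳ-⊆ (H +ᴳ spoke zero zero) G′ (spoke (suc zero) zero)
          (+ᴳ-⊆ H G′ (spoke zero zero) kept
            (spoke-moved zero (+ᴳ-old (two-spokes j H) (spoke (suc (suc zero)) j) (spoke zero j)
              (+ᴳ²-new₁ H (spoke zero j) (spoke (suc zero) j)))))
          (spoke-moved (suc zero) (+ᴳ-old (two-spokes j H) (spoke (suc (suc zero)) j) (spoke (suc zero) j)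
            (+ᴳ²-new₂ H (spoke zero j) (spoke (suc zero) j)))))
        (spoke-moved (suc (suc zero)) (+ᴳ-new (two-spokes j H) (spoke (suc (suc zero)) j)))

    -- `J` already has the spokes from a and b to copy j, so adding the spoke from c completes
    -- `extended j`.
    third-spoke-dependent : ¬ Indep (Mat (suc n)) (extended zero) →
                            ∀ j → ¬ Indep (Mat (suc n)) (J +ᴳ spoke (suc (suc zero)) j)
    third-spoke-dependent dep j i = dep (extended-swap j (indep-sub (Mat (suc n))
      (+ᴳ-mono (two-spokes j H) J (spoke (suc (suc zero)) j)
        (+ᴳ-⊆ (H +ᴳ spoke zero j) J (spoke (suc zero) j)
          (+ᴳ-⊆ H J (spoke zero j) (all-spokes-⊆ H) (all-spokes₀ H j)) (all-spokes₁ H j))) i))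

    K : Graph (suc n)
    K = image φ φ-inj K33

    K+base-dependent : ¬ Indep (Mat (suc n)) (K +ᴳ base)
    K+base-dependent i = K33+e₀₁-dependent (indep-sub (Mat 6) sub
      (indep-pullback φ φ-inj (s≤s (s≤s z≤n)) i))
      where
      sub : (K33 +ᴳ e₀₁) ⊆ᴳ pullback φ φ-inj (K +ᴳ base)
      sub = +ᴳ-⊆ K33 (pullback φ φ-inj (K +ᴳ base)) e₀₁
        (λ e e∈ → +ᴳ-old K base (mapEdge φ φ-inj e) (image-intro φ φ-inj K33 e e∈))
        (+ᴳ-new K base)

    -- If every third spoke were in the closure of J, then so would be the whole
    -- copy K of K₃,₃ and hence, K spanning K₆, the base; but J⁺ is independent.
    one-extension : ¬ ¬ Indep (Mat (suc n)) (extended zero)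
    one-extension dep = step (extend (Mat (suc n))
      (indep-image φ φ-inj (s≤s (s≤s z≤n)) K33-indep) J⁺-indep)
      where
      step : ¬ (∃ λ I → K ⊆ᴳ I × (∀ e → e ∈ᴳ I → e ∈ᴳ K ⊎ e ∈ᴳ J⁺) ×
                        Indep (Mat (suc n)) I × ∣ J⁺ ∣ᴱ ≤ ∣ I ∣ᴱ)
      step (I , K⊆I , I⊆ , iI , J⁺≤I) = step′ (indep-aug (Mat (suc n))
          (indep-sub (Mat (suc n)) J⊆J⁺ J⁺-indep) iI (≤-trans J<J⁺ J⁺≤I))
        where
        step′ : ¬ (∃ λ e → e ∈ᴳ I × J e ≡ false × Indep (Mat (suc n)) (J +ᴳ e))
        -- `I` is larger than `J` and so lends it an edge `e`. Spokes at a and b and edges of `H`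
        -- are already in `J`; a spoke at c is refused by dependence; the base would lie in `I`
        -- together with `K`.
        step′ (e , e∈I , e∉J , iJe) = [ inK , inJ⁺ ]′ (I⊆ e e∈I)
          where
          is-spoke : ∀ i j → ¬ e ≡ spoke i j
          is-spoke zero j refl = true≢false (all-spokes₀ H j) e∉J
          is-spoke (suc zero) j refl = true≢false (all-spokes₁ H j) e∉J
          is-spoke (suc (suc zero)) j refl = third-spoke-dependent dep j iJe
          inK : ¬ e ∈ᴳ K
          inK e∈K =
            let e₀ , e₀∈ , eq = image-elim φ φ-inj K33 e e∈K
                i , j , e₀≡ = K33-crossing e₀ e₀∈
            in is-spoke i j (trans (sym eq) (cong (mapEdge φ φ-inj) e₀≡))
          inJ⁺ : ¬ e ∈ᴳ J⁺
          inJ⁺ e∈ with all-spokes-elim (H +ᴳ base) e e∈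
          ... | inj₂ (i , j , eq) = is-spoke i j eq
          ... | inj₁ e∈H+ with +ᴳ-elim H base e∈H+
          ...   | inj₁ e∈H  = true≢false (all-spokes-⊆ H e e∈H) e∉J
          ...   | inj₂ refl = K+base-dependent (indep-sub (Mat (suc n)) (+ᴳ-⊆ K I base K⊆I e∈I) iI)

  -- Independence of K₃,₃

  -- C₄ is K₃,₃ minus the edge ij, built from the empty graph by four zero-extensions.
  module K33Chain (i j : Fin 3) where

    i₀ i₁ j₀ j₁ : Fin 3
    i₀ = punchIn i zero
    i₁ = punchIn i (suc zero)
    j₀ = punchIn j zero
    j₁ = punchIn j (suc zero)

    C₁ C₂ C₃ C₄ : Graph 6
    C₁ = (∅ᴳ +ᴳ crossing i₁ j₀) +ᴳ crossing i₁ j₁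
    C₂ = (C₁ +ᴳ crossing i₀ j₀) +ᴳ crossing i₀ j₁
    C₃ = (C₂ +ᴳ crossing i₀ j) +ᴳ crossing i₁ j
    C₄ = (C₃ +ᴳ crossing i j₀) +ᴳ crossing i j₁

    low-inj : Injective (λ (k : Fin 3) → k ↑ˡ 3)
    low-inj {x} {y} = FinP.↑ˡ-injective 3 x y

    high-inj : Injective (λ (k : Fin 3) → 3 ↑ʳ k)
    high-inj {x} {y} = FinP.↑ʳ-injective 3 x y

    pair-avoids-low : ∀ {k a b c d} (G : Graph 6) → k ≢ a → k ≢ c → Avoids (k ↑ˡ 3) G →
                      Avoids (k ↑ˡ 3) ((G +ᴳ crossing a b) +ᴳ crossing c d)
    pair-avoids-low {k} {a} {b} {c} {d} G k≢a k≢c av =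
      avoids-+ᴳ (G +ᴳ crossing a b)
        (avoids-+ᴳ G av (crossing-joins a b) (k≢a ∘ low-inj) (low≢high k b))
        (crossing-joins c d) (k≢c ∘ low-inj) (low≢high k d)

    pair-avoids-high : ∀ {k a b c d} (G : Graph 6) → k ≢ b → k ≢ d → Avoids (3 ↑ʳ k) G →
                       Avoids (3 ↑ʳ k) ((G +ᴳ crossing a b) +ᴳ crossing c d)
    pair-avoids-high {k} {a} {b} {c} {d} G k≢b k≢d av =
      avoids-+ᴳ (G +ᴳ crossing a b)
        (avoids-+ᴳ G av (crossing-joins a b) (λ eq → low≢high a k (sym eq)) (k≢b ∘ high-inj))
        (crossing-joins c d) (λ eq → low≢high c k (sym eq)) (k≢d ∘ high-inj)

    avoids-∅ : {v : Fin 6} → Avoids v ∅ᴳ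
    avoids-∅ x e J ()

    punch≢ : ∀ (a : Fin 3) {k l : Fin 2} → k ≢ l → punchIn a k ≢ punchIn a l
    punch≢ a k≢l eq = k≢l (punchIn-inj a eq)

    punch-off : ∀ (a : Fin 3) k → a ≢ punchIn a k
    punch-off a k eq = FinP.punchInᵢ≢i a k (sym eq)

    2≤5 : 2 ≤ 5
    2≤5 = s≤s (s≤s z≤n)

    C₄-indep : Indep (Mat 6) C₄
    -- From the inside out, the added vertices are i₁, i₀, j, i, each isolated in the graph before
    -- it.
    C₄-indep =
      zero-extension 2≤5 (crossing-joins i j₀) (crossing-joins i j₁)
        (punch≢ j (λ ()) ∘ high-inj) C₃
        (pair-avoids-low C₂ (punch-off i _) (punch-off i _)
          (pair-avoids-low C₁ (punch-off i _) (punch-off i _)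
            (pair-avoids-low ∅ᴳ (punch-off i _) (punch-off i _) avoids-∅)))
      (zero-extension 2≤5 (joins-sym (crossing-joins i₀ j)) (joins-sym (crossing-joins i₁ j))
        (punch≢ i (λ ()) ∘ low-inj) C₂
        (pair-avoids-high C₁ (punch-off j _) (punch-off j _)
          (pair-avoids-high ∅ᴳ (punch-off j _) (punch-off j _) avoids-∅))
      (zero-extension 2≤5 (crossing-joins i₀ j₀) (crossing-joins i₀ j₁)
        (punch≢ j (λ ()) ∘ high-inj) C₁
        (pair-avoids-low ∅ᴳ (punch≢ i (λ ())) (punch≢ i (λ ())) avoids-∅)
      (zero-extension 2≤5 (crossing-joins i₁ j₀) (crossing-joins i₁ j₁)
        (punch≢ j (λ ()) ∘ high-inj) ∅ᴳ avoids-∅ (indep-∅ (Mat 6)))))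

    -- A view of `Fin 3` from a distinguished point, matching the names i, i₀, i₁ and j, j₀, j₁.
    data Is (a : Fin 3) : Fin 3 → Set where
      itself : Is a a
      first  : Is a (punchIn a zero)
      second : Is a (punchIn a (suc zero))

    is : ∀ a b → Is a b
    is a b with a ≟ b
    ... | yes refl = itself
    ... | no a≢b with punchOut a≢b | FinP.punchIn-punchOut a≢b
    ...   | zero     | refl = first
    ...   | suc zero | refl = second

    C₃⊆ : C₃ ⊆ᴳ C₄
    C₃⊆ = +ᴳ²-old C₃ (crossing i j₀) (crossing i j₁)

    C₂⊆ : C₂ ⊆ᴳ C₄
    C₂⊆ x p = C₃⊆ x (+ᴳ²-old C₂ (crossing i₀ j) (crossing i₁ j) x p)

    C₁⊆ : C₁ ⊆ᴳ C₄
    C₁⊆ x p = C₂⊆ x (+ᴳ²-old C₁ (crossing i₀ j₀) (crossing i₀ j₁) x p)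

    crossing∈C₄ : ∀ a b → crossing a b ≢ crossing i j → crossing a b ∈ᴳ C₄
    crossing∈C₄ a b ≢ij with is i a | is j b
    ... | itself | itself = contradiction refl ≢ij
    ... | itself | first  = +ᴳ²-new₁ C₃ (crossing i j₀) (crossing i j₁)
    ... | itself | second = +ᴳ²-new₂ C₃ (crossing i j₀) (crossing i j₁)
    ... | first  | itself = C₃⊆ (crossing i₀ j) (+ᴳ²-new₁ C₂ (crossing i₀ j) (crossing i₁ j))
    ... | second | itself = C₃⊆ (crossing i₁ j) (+ᴳ²-new₂ C₂ (crossing i₀ j) (crossing i₁ j))
    ... | first  | first  = C₂⊆ (crossing i₀ j₀) (+ᴳ²-new₁ C₁ (crossing i₀ j₀) (crossing i₀ j₁))
    ... | first  | second = C₂⊆ (crossing i₀ j₁) (+ᴳ²-new₂ C₁ (crossing i₀ j₀) (crossing i₀ j₁))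
    ... | second | first  = C₁⊆ (crossing i₁ j₀) (+ᴳ²-new₁ ∅ᴳ (crossing i₁ j₀) (crossing i₁ j₁))
    ... | second | second = C₁⊆ (crossing i₁ j₁) (+ᴳ²-new₂ ∅ᴳ (crossing i₁ j₀) (crossing i₁ j₁))

  -- A proper subgraph misses some edge ij and so lies in the independent `C₄ i j`; were K₃,₃
  -- dependent, it would thus be a circuit.
  K33-¬¬indep : ¬ IsMCircuit (family F) 6 K33 → ¬ ¬ Indep (Mat 6) K33
  K33-¬¬indep ¬circuit dep = ¬circuit (dep , proper)
    where
    proper : ∀ H → H ⊂ᴳ K33 → Indep (Mat 6) H
    proper H (H⊆ , e , e∈ , e∉H) with K33-crossing e e∈
    ... | i , j , refl = indep-sub (Mat 6) sub (K33Chain.C₄-indep i j)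
      where
      sub : H ⊆ᴳ K33Chain.C₄ i j
      sub f f∈H with K33-crossing f (H⊆ f f∈H)
      ... | a , b , refl = K33Chain.crossing∈C₄ i j a b
        λ eq → true≢false f∈H (trans (cong H eq) e∉H)

-- Comparison with the rigidity matroid

joins-both : (X : Fin n → Bool) {a b : Fin n} {e : Edge n} → Joins a b e →
             X (lo e) ≡ true → X (hi e) ≡ true → X a ≡ true × X b ≡ true
joins-both X (fwd p) q r = q , r
joins-both X (bwd p) q r = r , q

∑-tabulate : ∀ {k} {A B : Set} (h : B → ℕ) (g : A → B) (f : Fin k → A) →
             ∑ h (tabulate (g ∘ f)) ≡ ∑ (h ∘ g) (tabulate f)
∑-tabulate {zero}  h g f = refl
∑-tabulate {suc k} h g f = cong (h (g (f zero)) +_) (∑-tabulate h g (f ∘ suc))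

∣tabulate∣ : (P : Fin n → Bool) → ∣ Vec.tabulate P ∣ ≡ card P
∣tabulate∣ {zero}  P = refl
∣tabulate∣ {suc n} P = trans (head (P zero) (Vec.tabulate (P ∘ suc))) (cong (ind (P zero) +_)
  (trans (∣tabulate∣ (P ∘ suc)) (sym (∑-tabulate (ind ∘ P) suc (λ i → i)))))
  where
  head : ∀ b (X : Subset n) → ∣ b ∷ X ∣ ≡ ind b + ∣ X ∣
  head true  X = refl
  head false X = refl

-- Makes a vertex subset the vertex set of a complete graph of its own, so that the rank on |X|
-- vertices bounds its induced edges.
enumerate : (X : Subset n) → ∃ λ (f : Fin ∣ X ∣ → Fin n) →
            Injective f × (∀ i → Vec.lookup X i ≡ true → ∃ λ j → f j ≡ i)
enumerate [] = (λ ()) , (λ {x} → ⊥-elim (FinP.¬Fin0 x)) , λ ()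
enumerate (false ∷ X) = let f , inj , onto = enumerate X in
  suc ∘ f , inj ∘ FinP.suc-injective , λ where
    (suc i) p → let j , eq = onto i p in j , cong suc eq
enumerate {suc n} (true ∷ X) with enumerate X
... | f , inj , onto = g , g-inj , g-onto
  where
  g : Fin (suc ∣ X ∣) → Fin (suc n)
  g zero    = zero
  g (suc i) = suc (f i)
  g-inj : Injective g
  g-inj {zero}  {zero}  _  = refl
  g-inj {suc x} {suc y} eq = cong suc (inj (FinP.suc-injective eq))
  g-onto : ∀ i → Vec.lookup (true ∷ X) i ≡ true → ∃ λ j → g j ≡ i
  g-onto zero    _ = zero , refl
  g-onto (suc i) p = let j , eq = onto i p in suc j , cong suc eq

suc² : Fin n → Fin (suc (suc n))
suc² i = suc (suc i)

suc²-inj : Injective (suc² {n})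
suc²-inj eq = FinP.suc-injective (FinP.suc-injective eq)

-- The two new vertices are isolated, so a set induces no more edges than its trace on the old
-- vertices. A trace of fewer than two vertices induces none, and 3 ≤ 2·2 covers that case.
RIndep⇒sparse : (G : Graph n) → RIndep G → Sparse (image suc² suc²-inj G)
RIndep⇒sparse {n} G rindep Y 2≤Y = bound (2 ≤? ∣ Y′ ∣)
  where
  open ≤-Reasoning
  G⁺ = image suc² suc²-inj G
  Y′ : Subset n
  Y′ = Vec.tabulate (Y ∘ suc²)
  card-Y′ : ∣ Y′ ∣ ≤ card Y
  card-Y′ = begin
    ∣ Y′ ∣                                                ≡⟨ ∣tabulate∣ (Y ∘ suc²) ⟩
    card (Y ∘ suc²)                                       ≡⟨ sym (∑-tabulate (ind ∘ Y) suc² (λ i → i)) ⟩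
    ∑ (ind ∘ Y) (tabulate suc²)                           ≤⟨ ℕP.m≤n+m _ (ind (Y (suc zero))) ⟩
    ind (Y (suc zero)) + ∑ (ind ∘ Y) (tabulate suc²)      ≤⟨ ℕP.m≤n+m _ (ind (Y zero)) ⟩
    card Y                                                ∎
  onto : ∀ e′ → e′ ∈ᴳ G⁺ [ Y ] → ∃ λ e → mapEdge suc² suc²-inj e ≡ e′
  onto e′ e′∈ = let e , _ , eq = image-elim suc² suc²-inj G e′ (proj₁ ([]-elim G⁺ Y e′ e′∈)) in e , eq
  lookup-Y′ : ∀ x → Y (suc² x) ≡ true → Vec.lookup Y′ x ≡ true
  lookup-Y′ x p = trans (VecP.lookup∘tabulate (Y ∘ suc²) x) p
  back : pullback suc² suc²-inj (G⁺ [ Y ]) ⊆ᴳ G [ Vec.lookup Y′ ]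
  back e e∈ =
    let p , q , r = []-elim G⁺ Y (mapEdge suc² suc²-inj e) e∈
        e₀ , e₀∈ , eq = image-elim suc² suc²-inj G _ p
        s , t = joins-both Y (mapEdge-joins suc² suc²-inj (joins-self e)) q r
    in []-intro G (Vec.lookup Y′) e
         (subst (_∈ᴳ G) (mapEdge-injective suc² suc²-inj eq) e₀∈) (lookup-Y′ _ s) (lookup-Y′ _ t)
  induced : ∣ G⁺ [ Y ] ∣ᴱ ≤ ∣ G [ Vec.lookup Y′ ] ∣ᴱ
  induced = ≤-trans (size-pullback suc² suc²-inj (G⁺ [ Y ]) onto)
    (size-mono (pullback suc² suc²-inj (G⁺ [ Y ])) (G [ Vec.lookup Y′ ]) back)
  card-lookup : card (Vec.lookup Y′) ≡ ∣ Y′ ∣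
  card-lookup = trans (∑-cong (allFin n) λ x → cong ind (VecP.lookup∘tabulate (Y ∘ suc²) x))
    (sym (∣tabulate∣ (Y ∘ suc²)))
  bound : Dec (2 ≤ ∣ Y′ ∣) → ∣ G⁺ [ Y ] ∣ᴱ + 3 ≤ 2 * card Y
  bound (yes 2≤Y′) = begin
    ∣ G⁺ [ Y ] ∣ᴱ + 3               ≤⟨ ℕP.+-monoˡ-≤ 3 (≤-trans induced (rindep Y′ 2≤Y′)) ⟩
    2 * ∣ Y′ ∣ ∸ 3 + 3              ≡⟨ ℕP.m∸n+n≡m (≤-trans (s≤s (s≤s (s≤s z≤n))) (ℕP.*-monoʳ-≤ 2 2≤Y′)) ⟩
    2 * ∣ Y′ ∣                      ≤⟨ ℕP.*-monoʳ-≤ 2 card-Y′ ⟩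
    2 * card Y                      ∎
  bound (no small) = begin
    ∣ G⁺ [ Y ] ∣ᴱ + 3               ≤⟨ ℕP.+-monoˡ-≤ 3 (≤-trans induced (≤-reflexive
                                        (size-[]-small G (Vec.lookup Y′) (subst (λ k → ¬ 2 ≤ k) (sym card-lookup) small)))) ⟩
    3                               ≤⟨ ℕP.n≤1+n 3 ⟩
    2 * 2                           ≤⟨ ℕP.*-monoʳ-≤ 2 2≤Y ⟩
    2 * card Y                      ∎

module Comparison (F : RigidityFamily2) where
  open Family (family F)
  open Rigidity F

  indep⇒RIndep : 2 ≤ n → (H : Graph n) → Indep (Mat n) H → RIndep H
  indep⇒RIndep {n} 2≤n H iH X 2≤X = ≤-trans
    (size-pullback f f-inj A onto)
    (proj₂ (rank F ∣ X ∣ 2≤X) (pullback f f-inj A)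
      (indep-pullback f f-inj 2≤X (indep-sub (Mat n) (λ e p → proj₁ ([]-elim H (Vec.lookup X) e p)) iH)))
    where
    A = H [ Vec.lookup X ]
    f = proj₁ (enumerate X)
    f-inj : Injective f
    f-inj = proj₁ (proj₂ (enumerate X))
    onto : ∀ e′ → e′ ∈ᴳ A → ∃ λ e → mapEdge f f-inj e ≡ e′
    onto e′ e′∈ =
      let _ , p , q = []-elim H (Vec.lookup X) e′ e′∈
          i , fi≡ = proj₂ (proj₂ (enumerate X)) (lo e′) p
          j , fj≡ = proj₂ (proj₂ (enumerate X)) (hi e′) q
          e , _ , eq = mapEdge-preimage f f-inj {i} {j}
                         (joins-cong (sym fi≡) (sym fj≡) (joins-self e′))
      in e , eq

  -- Sparse graphs are independent

  module Induction {n : ℕ} (1≤n : 1 ≤ n) (K33-indep : Indep (Mat 6) K33) where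

    V : Set
    V = Fin (suc (suc n))

    Ind : Graph (suc (suc n)) → Set
    Ind = Indep (Mat (suc (suc n)))

    2≤1+n : 2 ≤ suc n
    2≤1+n = s≤s 1≤n

    outside-≢ : (X : V → Bool) {x w : V} → X x ≡ true → X w ≡ false → x ≢ w
    outside-≢ X Xx Xw refl = true≢false Xx Xw

    supported-avoids : (G : Graph (suc (suc n))) (X : V → Bool) → SupportedIn G X →
                       {w : V} → X w ≡ false → Avoids w G
    supported-avoids G X supp Xw x e J e∈ = true≢false (proj₁ (supported-joins G X supp J e∈)) Xw

    remove : (V → Bool) → V → V → Bool
    remove X v x = X x ∧ not (does (x ≟ v))

    remove-intro : (X : V → Bool) {v x : V} → X x ≡ true → x ≢ v → remove X v x ≡ true
    remove-intro X {v} {x} Xx x≢v = ∧-intro Xx (not-intro (dec-false (x ≟ v) x≢v))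

    card-remove : (X : V → Bool) (v : V) → X v ≡ true → suc (card (remove X v)) ≤ card X
    card-remove X v Xv = begin
      1 + card (remove X v)
        ≡⟨ cong (_+ card (remove X v)) (sym (∑-fin-singleton v)) ⟩
      ∑ (λ x → ind (does (x ≟ v))) (allFin _) + card (remove X v)
        ≡⟨ sym (∑-+ (λ x → ind (does (x ≟ v))) (ind ∘ remove X v) (allFin _)) ⟩
      ∑ (λ x → ind (does (x ≟ v)) + ind (remove X v x)) (allFin _)
        ≤⟨ ∑-mono (allFin _) pointwise ⟩
      card X ∎
      where
      open ≤-Reasoning
      pointwise : ∀ x → ind (does (x ≟ v)) + ind (remove X v x) ≤ ind (X x)
      pointwise x with x ≟ v
      ... | yes refl rewrite Xv = ≤-refl
      ... | no _ with X x
      ...   | true  = ≤-refl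
      ...   | false = ≤-refl

    -- The vertices 0 and 1 stay outside X: they serve as the two further copies of
    -- the deleted vertex in the one-extension.
    Claim : ℕ → Set
    Claim k = ∀ X G → card X ≤ k → X zero ≡ false → X (suc zero) ≡ false →
              SupportedIn G X → Sparse G → ¬ ¬ Ind G

    module Step {k : ℕ} (claim : Claim k) (X : V → Bool) (G : Graph (suc (suc n)))
      (X≤ : card X ≤ suc k) (X₀ : X zero ≡ false) (X₁ : X (suc zero) ≡ false)
      (supp : SupportedIn G X) (sparse : Sparse G) (v : V) (Xv : X v ≡ true) where

      H : Graph (suc (suc n))
      H = G ∖ v

      X′ : V → Bool
      X′ = remove X v

      H-sparse : Sparse H
      H-sparse = sparse-⊆ H G (∖-⊆ G v) sparse

      X′≤ : card X′ ≤ k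
      X′≤ = s≤s⁻¹ (≤-trans (card-remove X v Xv) X≤)

      H-supp : SupportedIn H X′
      H-supp e e∈ = let p , q = supp e (∖-⊆ G v e e∈) in
        remove-intro X p (λ { refl → ∖-avoids G v _ e (joins-self e) e∈ }) ,
        remove-intro X q (λ { refl → ∖-avoids G v _ e (joins-sym (joins-self e)) e∈ })

      H-indep : ¬ ¬ Ind H
      H-indep = claim X′ H X′≤ (cong (_∧ _) X₀) (cong (_∧ _) X₁) H-supp H-sparse

      degree-two : ∀ {a b e f} → Joins v a e → Joins v b f → a ≢ b →
                   G ⊆ᴳ ((H +ᴳ e) +ᴳ f) → ¬ ¬ Ind G
      degree-two Je Jf a≢b G⊆ dep = H-indep λ iH → dep (indep-sub (Mat (suc (suc n))) G⊆
        (zero-extension 2≤1+n Je Jf a≢b H (∖-avoids G v) iH))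

      -- A zero-extension needs two neighbours. Vertex 0 lies outside X, hence differs from v and a,
      -- and lends a second edge that is dropped again.
      degree-one : ∀ {a e} → Joins v a e → X a ≡ true → G ⊆ᴳ (H +ᴳ e) → ¬ ¬ Ind G
      degree-one {e = e} J Xa G⊆ = let f , Jf = joining (outside-≢ X Xv X₀) in
        degree-two J Jf (outside-≢ X Xa X₀) λ h p → +ᴳ-old (H +ᴳ e) f h (G⊆ h p)

      -- Without such a tight set, `H` plus the edge ab is sparse on a smaller support, hence
      -- independent by induction, and the one-extension recovers `G`. Assuming `G` dependent allows
      -- three pairs to be treated alike, without searching for a good one.
      tight-pair : ∀ {a b c e f g} → Joins v a e → Joins v b f → Joins v c g →
                   a ≢ b → a ≢ c → b ≢ c → X a ≡ true → X b ≡ true → X c ≡ true →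
                   (∀ h → h ∈ᴳ G → h ∈ᴳ H ⊎ (h ≡ e ⊎ h ≡ f ⊎ h ≡ g)) → ¬ Ind G →
                   ¬ ¬ (∃ λ Y → Y a ≡ true × Y b ≡ true × Y v ≡ false × Tight H Y)
      tight-pair {a} {b} {c} {e} {f} {g} Je Jf Jg a≢b a≢c b≢c Xa Xb Xc G⊆ dep ¬tight =
        claim X′ (H +ᴳ base) X′≤ (cong (_∧ _) X₀) (cong (_∧ _) X₁) base-supp (proj₂ reduced)
          λ i → let open OneExtension 2≤1+n K33-indep φ φ-inj H avoids (proj₁ reduced) i
                in one-extension λ ext → dep (indep-sub (Mat (suc (suc n))) (covered (spoke-joins zero zero)
                     (spoke-joins (suc zero) zero) (spoke-joins (suc (suc zero)) zero)) ext)
        where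
        φ : Fin 6 → V
        -- The spare vertices 0 and 1 are the second and third copies of v.
        φ = Vec.lookup (a ∷ b ∷ c ∷ v ∷ zero ∷ suc zero ∷ [])
        out : ∀ {x} → X x ≡ true → x ≢ zero × x ≢ suc zero
        out Xx = outside-≢ X Xx X₀ , outside-≢ X Xx X₁
        φ-inj : Injective φ
        φ-inj {i} {j} = VecU.lookup-injective
          ( (a≢b ∷ a≢c ∷ (λ eq → joins-≢ Je (sym eq)) ∷ proj₁ (out Xa) ∷ proj₂ (out Xa) ∷ [])
          ∷ (b≢c ∷ (λ eq → joins-≢ Jf (sym eq)) ∷ proj₁ (out Xb) ∷ proj₂ (out Xb) ∷ [])
          ∷ ((λ eq → joins-≢ Jg (sym eq)) ∷ proj₁ (out Xc) ∷ proj₂ (out Xc) ∷ [])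
          ∷ (proj₁ (out Xv) ∷ proj₂ (out Xv) ∷ [])
          ∷ ((λ ()) ∷ [])
          ∷ [] ∷ []) i j
        base : Edge (suc (suc n))
        base = mapEdge φ φ-inj e₀₁
        base-joins : Joins a b base
        base-joins = mapEdge-joins φ φ-inj (fwd (s≤s z≤n))
        reduced : H base ≡ false × Sparse (H +ᴳ base)
        reduced = reduction H H-sparse base-joins (joins-≢ Je) (joins-≢ Jf) (∖-avoids G v) ¬tight
        base-supp : SupportedIn (H +ᴳ base) X′
        base-supp h h∈ with +ᴳ-elim H base h∈
        ... | inj₁ p    = H-supp h p
        ... | inj₂ refl = ends base-joins
          where
          X′a = remove-intro X Xa (λ eq → joins-≢ Je (sym eq))
          X′b = remove-intro X Xb (λ eq → joins-≢ Jf (sym eq))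
          ends : ∀ {h} → Joins a b h → X′ (lo h) ≡ true × X′ (hi h) ≡ true
          ends (fwd _) = X′a , X′b
          ends (bwd _) = X′b , X′a
        avoids : ∀ j → Avoids (φ (3 ↑ʳ j)) H
        avoids zero             = ∖-avoids G v
        avoids (suc zero)       = supported-avoids H X (λ h p → supp h (∖-⊆ G v h p)) X₀
        avoids (suc (suc zero)) = supported-avoids H X (λ h p → supp h (∖-⊆ G v h p)) X₁
        covered : ∀ {e′ f′ g′} → Joins a v e′ → Joins b v f′ → Joins c v g′ →
                  G ⊆ᴳ (((H +ᴳ e′) +ᴳ f′) +ᴳ g′)
        covered {e′} {f′} {g′} Je′ Jf′ Jg′ h h∈ with joins-unique Je (joins-sym Je′)
          | joins-unique Jf (joins-sym Jf′) | joins-unique Jg (joins-sym Jg′) | G⊆ h h∈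
        ... | refl | refl | refl | inj₁ p = +ᴳ-old ((H +ᴳ e) +ᴳ f) g h (+ᴳ²-old H e f h p)
        ... | refl | refl | refl | inj₂ (inj₁ refl) = +ᴳ-old ((H +ᴳ e) +ᴳ f) g e (+ᴳ²-new₁ H e f)
        ... | refl | refl | refl | inj₂ (inj₂ (inj₁ refl)) = +ᴳ-old ((H +ᴳ e) +ᴳ f) g f (+ᴳ²-new₂ H e f)
        ... | refl | refl | refl | inj₂ (inj₂ (inj₂ refl)) = +ᴳ-new ((H +ᴳ e) +ᴳ f) g

      -- Dependence of `G` yields tight sets through ab, bc and ac, all missing v; their merger
      -- contains all three neighbours, which degree 3 at v forbids.
      degree-three : ∀ {a b c e f g} → Joins v a e → Joins v b f → Joins v c g →
                     e ≢ f → e ≢ g → f ≢ g → e ∈ᴳ G → f ∈ᴳ G → g ∈ᴳ G →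
                     (∀ h → h ∈ᴳ G → h ∈ᴳ H ⊎ (h ≡ e ⊎ h ≡ f ⊎ h ≡ g)) → ¬ ¬ Ind G
      degree-three {a} {b} {c} {e} {f} {g} Je Jf Jg e≢f e≢g f≢g e∈ f∈ g∈ G⊆ dep =
        tight-pair Je Jf Jg a≢b a≢c b≢c Xa Xb Xc G⊆ dep λ (Y₁ , Y₁a , Y₁b , Y₁v , t₁) →
        tight-pair Jf Jg Je b≢c (≢-sym a≢b) (≢-sym a≢c) Xb Xc Xa
          (λ h p → rotate (G⊆ h p)) dep λ (Y₂ , Y₂b , Y₂c , Y₂v , t₂) →
        tight-pair Je Jg Jf a≢c a≢b (≢-sym b≢c) Xa Xc Xb
          (λ h p → swap (G⊆ h p)) dep λ (Y₃ , Y₃a , Y₃c , Y₃v , t₃) →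
        let W , tW , Wa , Wb , Wc , out = tight-triangle H H-sparse a≢b b≢c a≢c
              Y₁ Y₂ Y₃ Y₁a Y₁b Y₂b Y₂c Y₃a Y₃c t₁ t₂ t₃
        in degree-three-not-tight G H sparse (∖-⊆ G v) (∖-avoids G v) Je Jf Jg e≢f e≢g f≢g e∈ f∈ g∈
             W Wa Wb Wc (out v Y₁v Y₂v Y₃v) tW
        where
        distinct : ∀ {x y h i} → Joins v x h → Joins v y i → h ≢ i → x ≢ y
        distinct J K h≢i x≡y = h≢i (joins-unique J (joins-cong refl (sym x≡y) K))
        a≢b = distinct Je Jf e≢f
        a≢c = distinct Je Jg e≢g
        b≢c = distinct Jf Jg f≢g
        Xa = proj₂ (supported-joins G X supp Je e∈)
        Xb = proj₂ (supported-joins G X supp Jf f∈)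
        Xc = proj₂ (supported-joins G X supp Jg g∈)
        rotate : ∀ {P A B C : Set} → P ⊎ (A ⊎ B ⊎ C) → P ⊎ (B ⊎ C ⊎ A)
        rotate (inj₁ p)               = inj₁ p
        rotate (inj₂ (inj₁ a))        = inj₂ (inj₂ (inj₂ a))
        rotate (inj₂ (inj₂ (inj₁ b))) = inj₂ (inj₁ b)
        rotate (inj₂ (inj₂ (inj₂ c))) = inj₂ (inj₂ (inj₁ c))
        swap : ∀ {P A B C : Set} → P ⊎ (A ⊎ B ⊎ C) → P ⊎ (A ⊎ C ⊎ B)
        swap (inj₁ p)               = inj₁ p
        swap (inj₂ (inj₁ a))        = inj₂ (inj₁ a)
        swap (inj₂ (inj₂ (inj₁ b))) = inj₂ (inj₂ (inj₂ b))
        swap (inj₂ (inj₂ (inj₂ c))) = inj₂ (inj₂ (inj₁ c))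

      low-degree-step : ∣ star G v ∣ᴱ ≤ 3 → ¬ ¬ Ind G
      low-degree-step deg with list-edges 3 (star G v) deg
      ... | [] , _ , _ , _ , cover = λ dep → H-indep λ iH → dep (indep-sub (Mat (suc (suc n)))
              (λ h h∈ → [ (λ p → p) , (λ p → ⊥-elim (nil (cover h p))) ]′ (∖-or-star G v h h∈)) iH)
        where
        nil : ∀ {h : Edge (suc (suc n))} → ¬ h ∈ []
        nil ()
      ... | e ∷ [] , _ , _ , e∈ ∷ [] , cover =
        let _ , Je = star-joins G v e e∈ in
        degree-one Je (proj₂ (supported-joins G X supp Je (proj₁ (∧-true {G e} e∈))))
          λ h h∈ → [ +ᴳ-old H e h , (λ p → only (cover h p)) ]′ (∖-or-star G v h h∈)
        where
        only : ∀ {h} → h ∈ e ∷ [] → h ∈ᴳ (H +ᴳ e)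
        only (here refl) = +ᴳ-new H e
      ... | e ∷ f ∷ [] , _ , (e≢f ∷ []) ∷ _ , e∈ ∷ f∈ ∷ [] , cover =
        let _ , Je = star-joins G v e e∈
            _ , Jf = star-joins G v f f∈
        in degree-two Je Jf (λ eq → e≢f (joins-unique Je (joins-cong refl (sym eq) Jf)))
          λ h h∈ → [ +ᴳ²-old H e f h , (λ p → only (cover h p)) ]′ (∖-or-star G v h h∈)
        where
        only : ∀ {h} → h ∈ e ∷ f ∷ [] → h ∈ᴳ ((H +ᴳ e) +ᴳ f)
        only (here refl)         = +ᴳ²-new₁ H e f
        only (there (here refl)) = +ᴳ²-new₂ H e f
      ... | e ∷ f ∷ g ∷ [] , _ , (e≢f ∷ e≢g ∷ []) ∷ (f≢g ∷ []) ∷ _ , e∈ ∷ f∈ ∷ g∈ ∷ [] , cover =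
        let _ , Je = star-joins G v e e∈
            _ , Jf = star-joins G v f f∈
            _ , Jg = star-joins G v g g∈
        in degree-three Je Jf Jg e≢f e≢g f≢g
             (proj₁ (∧-true {G e} e∈)) (proj₁ (∧-true {G f} f∈)) (proj₁ (∧-true {G g} g∈))
             λ h h∈ → [ inj₁ , (λ p → inj₂ (only (cover h p))) ]′ (∖-or-star G v h h∈)
        where
        only : ∀ {h} → h ∈ e ∷ f ∷ g ∷ [] → h ≡ e ⊎ h ≡ f ⊎ h ≡ g
        only (here eq)                 = inj₁ eq
        only (there (here eq))         = inj₂ (inj₁ eq)
        only (there (there (here eq))) = inj₂ (inj₂ eq)
      ... | _ ∷ _ ∷ _ ∷ _ ∷ _ , s≤s (s≤s (s≤s ())) , _

    empty-indep : ∀ X G → SupportedIn G X → ¬ 1 ≤ card X → Ind G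
    empty-indep X G supp empty = indep-sub (Mat (suc (suc n)))
      (λ e e∈ → let p , q = supp e e∈ in
        contradiction (≤-trans (s≤s z≤n) (∈[]⇒2≤ G X e ([]-intro G X e e∈ p q))) empty)
      (indep-∅ (Mat (suc (suc n))))

    -- The induction shrinks the support and keeps the ambient matroid fixed, so the spare vertices
    -- remain available at every stage.
    sparse⇒indep : ∀ k → Claim k
    sparse⇒indep zero X G X≤ X₀ X₁ supp sparse dep =
      dep (empty-indep X G supp λ 1≤X → contradiction (≤-trans 1≤X X≤) λ ())
    sparse⇒indep (suc k) X G X≤ X₀ X₁ supp sparse with 1 ≤? card X
    ... | no empty = λ dep → dep (empty-indep X G supp empty)
    ... | yes 1≤X = let v , Xv , deg = low-degree G X sparse supp 1≤X in
      Step.low-degree-step (sparse⇒indep k) X G X≤ X₀ X₁ supp sparse v Xv deg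

  RIndep⇒¬¬indep : Indep (Mat 6) K33 → 2 ≤ n → (G : Graph n) → RIndep G → ¬ ¬ Indep (Mat n) G
  RIndep⇒¬¬indep {n} K33-indep 2≤n G rindep dep =
    Induction.sparse⇒indep (≤-trans (s≤s z≤n) 2≤n) K33-indep (card old) old G⁺ ≤-refl refl refl
      supp (RIndep⇒sparse G rindep)
      λ i → dep (indep-sub (Mat n) (image-intro suc² suc²-inj G) (indep-pullback suc² suc²-inj 2≤n i))
    where
    G⁺ = image suc² suc²-inj G
    old : Fin (suc (suc n)) → Bool
    old zero          = false
    old (suc zero)    = false
    old (suc (suc _)) = true
    supp : SupportedIn G⁺ old
    supp e′ e′∈ with image-elim suc² suc²-inj G e′ e′∈
    ... | e , _ , refl = ends (mapEdge-joins suc² suc²-inj (joins-self e))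
      where
      ends : ∀ {i j h} → Joins (suc² i) (suc² j) h → old (lo h) ≡ true × old (hi h) ≡ true
      ends (fwd _) = refl , refl
      ends (bwd _) = refl , refl

-- From independent sets to circuits

theorem4p2 : (F : RigidityFamily2) →
    ¬ IsMCircuit (family F) 6 K33 →
    ∀ (n : ℕ) (G : Graph n) → IsMCircuit (family F) n G → IsRCircuit n G
-- With fewer than two vertices there are no edges, so no graph is dependent.
theorem4p2 F ¬K33 zero G (dep , _) =
  ⊥-elim (dep (indep-sub (M (family F) 0) (λ { (edge () _ _) }) (indep-∅ (M (family F) 0))))
theorem4p2 F ¬K33 (suc zero) G (dep , _) =
  ⊥-elim (dep (indep-sub (M (family F) 1) (λ { (edge zero zero ()) }) (indep-∅ (M (family F) 1))))
theorem4p2 F ¬K33 n@(suc (suc _)) G (dep , proper) =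
  -- The goal here is absurdity, so both double negations can be discharged; minimality needs only
  -- the direct implication on proper subgraphs.
  (λ rindep → Rigidity.K33-¬¬indep F ¬K33 λ K33-indep →
    RIndep⇒¬¬indep K33-indep (s≤s (s≤s z≤n)) G rindep dep) ,
  (λ H H⊂G → indep⇒RIndep (s≤s (s≤s z≤n)) H (proper H H⊂G))
  where open Comparison F
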